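{- Let $G$ and $H$ be connected graphs on $n$ vertices. If $G\geq_e H$ then $\alpha(G)\geq \alpha(H)$.
   Context: All graphs are finite and simple. $\alpha(G)$ is the independence number of $G$ (the maximum size of a set of pairwise non-adjacent vertices). The chromatic symmetric function of a graph $G$ with vertices $v_1,\dots,v_n$ is $X_G=\sum_{\kappa}x_{\kappa(v_1)}\cdots x_{\kappa(v_n)}$, summed over all proper colorings $\kappa:V(G)\to\{1,2,3,\dots\}$; it is a homogeneous symmetric function of degree $n$ over $\mathbb{Q}$. Let $e_\lambda=e_{\lambda_1}e_{\lambda_2}\cdots$ be the elementary symmetric functions; $[e_\lambda]F$ denotes the coefficient of $e_\lambda$ in $F$ expanded in this basis, and $F$ is $e$-positive if $[e_\lambda]F\ge 0$ for all $\lambda$. For connected graphs $G,H$ on $n$ vertices (for which $[e_{(n)}]X_G$ and $[e_{(n)}]X_H$ are positive), set $$X_e(G,H)=X_G-\frac{[e_{(n)}]X_G}{[e_{(n)}]X_H}X_H,$$ and write $G\geq_e H$ if $X_e(G,H)$ is $e$-positive. -}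

module Defs where

open import Data.Bool.Base using (if_then_else_)
open import Data.Fin.Base using (Fin)
import Data.Fin.Properties as Fin
open import Data.Fin.Subset using (Subset; inside; outside; _∈_; ∣_∣)
open import Data.Fin.Subset.Properties using (_∈?_)
open import Data.Integer.Base using (+_)
open import Data.List.Base using (List; []; _∷_; map; foldr; filter; concatMap; upTo; allFin; length; cartesianProductWith)
open import Data.List.Extrema.Nat using (max)
open import Data.List.Relation.Unary.All using (All)
import Data.List.Relation.Unary.All as All
open import Data.List.Relation.Unary.Linked using (Linked; linked?)
open import Data.Nat.Base as ℕ using (ℕ; zero; suc; _∸_)
open import Data.Nat.ListAction using (sum)
import Data.Nat.Properties as ℕ
open import Data.Product.Base using (Σ-syntax; ∃-syntax; _×_)
open import Data.Rational.Base using (ℚ; 0ℚ; 1ℚ; _+_; _*_; _-_; _÷_; _/_; _≤_; NonZero)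
open import Data.Vec.Base as Vec using (Vec; []; _∷_; lookup; tabulate; count; zipWith; toList)
import Data.Vec.Properties as Vec
import Data.Vec.Relation.Unary.All as VecAll
open import Level using (0ℓ)
open import Relation.Binary.Construct.Closure.ReflexiveTransitive using (Star)
open import Relation.Binary.Core using (Rel)
open import Relation.Binary.Definitions using (Symmetric; Irreflexive; Decidable)
open import Relation.Binary.PropositionalEquality.Core using (_≡_; _≢_)
open import Relation.Nullary.Decidable using (Dec; does; ¬?; _×-dec_; _→-dec_)
open import Relation.Nullary.Negation using (¬_)

record Graph (n : ℕ) : Set₁ where
  field
    _~_      : Rel (Fin n) 0ℓ
    ~-sym    : Symmetric _~_
    ~-irrefl : Irreflexive _≡_ _~_
    _~?_     : Decidable _~_

-- The graph with no vertices does not count as connected.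

Connected : ∀ {n} → Graph n → Set
Connected {n} G = ℕ.NonZero n × (∀ u v → Star _~_ u v)
  where open Graph G

sequences : ∀ {A : Set} → List A → (n : ℕ) → List (Vec A n)
sequences xs zero    = [] ∷ []
sequences xs (suc n) = cartesianProductWith _∷_ xs (sequences xs n)

module _ {n} (G : Graph n) where
  open Graph G

  Stable : Subset n → Set
  Stable S = ∀ u → u ∈ S → ∀ v → v ∈ S → ¬ (u ~ v)

  stable? : ∀ S → Dec (Stable S)
  stable? S = Fin.all? λ u → (u ∈? S) →-dec
              (Fin.all? λ v → (v ∈? S) →-dec ¬? (u ~? v))

  -- The default value 0 does not affect the maximum: the empty set is stable.

  α : ℕ
  α = max 0 (map ∣_∣ (filter stable? (sequences (inside ∷ outside ∷ []) n)))

  Proper : ∀ {N} → Vec (Fin N) n → Set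
  Proper κ = ∀ u v → u ~ v → lookup κ u ≢ lookup κ v

  proper? : ∀ {N} (κ : Vec (Fin N) n) → Dec (Proper κ)
  proper? κ = Fin.all? λ u → Fin.all? λ v →
              (u ~? v) →-dec ¬? (lookup κ u Fin.≟ lookup κ v)

-- Formal power series over ℚ in x₁, x₂, x₃, …, as coefficient functions:
-- F N a is the coefficient of x₁^a₁ ⋯ x_N^a_N in F.  Every monomial has this
-- form for some N.  The type does not force the coefficient to be unchanged
-- when zeros are appended to a, but all the series built below have this
-- property.

PowerSeries : Set
PowerSeries = (N : ℕ) → Vec ℕ N → ℚ

∑ : List ℚ → ℚ
∑ = foldr _+_ 0ℚ

infixl 6 _⊖_
infixl 7 _⊛_
infixr 7 _·_

_⊖_ : PowerSeries → PowerSeries → PowerSeries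
(F ⊖ F′) N a = F N a - F′ N a

_·_ : ℚ → PowerSeries → PowerSeries
(q · F) N a = q * F N a

-- All exponent vectors that are componentwise at most a.

below : ∀ {N} → Vec ℕ N → List (Vec ℕ N)
below []      = [] ∷ []
below (k ∷ a) = cartesianProductWith _∷_ (upTo (suc k)) (below a)

-- Cauchy product: the monomials dividing x^a are the x^b with b below a, and
-- the cofactor of x^b is x^(a ∸ b).

_⊛_ : PowerSeries → PowerSeries → PowerSeries
(F ⊛ F′) N a = ∑ (map (λ b → F N b * F′ N (zipWith _∸_ a b)) (below a))

-- e k is the sum of all squarefree monomials of degree k; in particular e 0
-- is the constant series 1.

e : ℕ → PowerSeries
e k N a = if does (VecAll.all? (ℕ._≤? 1) a ×-dec (Vec.sum a ℕ.≟ k)) then 1ℚ else 0ℚ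

e[_] : List ℕ → PowerSeries
e[ λs ] = foldr (λ k F → e k ⊛ F) (e 0) λs

-- The exponent vector of the monomial x_κ(v₁) ⋯ x_κ(vₙ).

content : ∀ {N n} → Vec (Fin N) n → Vec ℕ N
content κ = tabulate λ i → count (i Fin.≟_) κ

-- Chromatic symmetric function.  A colouring whose monomial is
-- x₁^a₁ ⋯ x_N^a_N uses only the first N colours, so the coefficient of that
-- monomial is the number of proper colourings Fin n → Fin N with content a.

X : ∀ {n} → Graph n → PowerSeries
X {n} G N a = + length (filter (λ κ → proper? G κ ×-dec Vec.≡-dec ℕ._≟_ (content κ) a)
                               (sequences (allFin N) n)) / 1

infix 4 _⊢_

_⊢_ : List ℕ → ℕ → Set
λs ⊢ n = All (ℕ._≥ 1) λs × Linked ℕ._≥_ λs × sum λs ≡ n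

_⊢?_ : ∀ λs n → Dec (λs ⊢ n)
λs ⊢? n = All.all? (ℕ._≥? 1) λs ×-dec linked? ℕ._≥?_ λs ×-dec (sum λs ℕ.≟ n)

-- A partition of n has at most n parts, each at most n.

partitions : ℕ → List (List ℕ)
partitions n = filter (_⊢? n)
  (concatMap (λ ℓ → map toList (sequences (upTo (suc n)) ℓ)) (upTo (suc n)))

-- F = Σ_{λ ⊢ n} c(λ) e_λ.  Only the values of c at partitions of n matter.

EExpansion : ℕ → PowerSeries → (List ℕ → ℚ) → Set
EExpansion n F c =
  ∀ N (a : Vec ℕ N) → F N a ≡ ∑ (map (λ λs → c λs * e[ λs ] N a) (partitions n))

-- [e_λ] F = q, for F homogeneous of degree n and λ ⊢ n.

ECoefficient : ℕ → List ℕ → PowerSeries → ℚ → Set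
ECoefficient n λs F q = ∃[ c ] EExpansion n F c × c λs ≡ q

EPositive : ℕ → PowerSeries → Set
EPositive n F = ∃[ c ] EExpansion n F c × (∀ λs → λs ⊢ n → 0ℚ ≤ c λs)

-- X_e(G , H), where p = [e_(n)] X_G and q = [e_(n)] X_H.

Xₑ : ∀ {n} → Graph n → Graph n → (p q : ℚ) → .{{NonZero q}} → PowerSeries
Xₑ G H p q = X G ⊖ (p ÷ q) · X H

infix 4 _≥ₑ_

-- Since the e_λ are linearly independent, p and q are determined by G and H.
-- For connected graphs both are positive, but only q ≢ 0, which the quotient
-- needs in order to be defined, is part of the relation.

_≥ₑ_ : ∀ {n} → Graph n → Graph n → Set
_≥ₑ_ {n} G H =
  ∃[ p ] ∃[ q ] Σ[ q≢0 ∈ NonZero q ]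
    ECoefficient n (n ∷ []) (X G) p ×
    ECoefficient n (n ∷ []) (X H) q ×
    EPositive n (Xₑ G H p q {{q≢0}})

module Submission where

-- Products of elementary symmetric functions have nonnegative monomial
-- coefficients, so if p = [e_(n)] X_G and q = [e_(n)] X_H are positive, every
-- monomial of X_H also occurs in X_G.  Colour a maximum stable set of H with
-- one colour and the other vertices with distinct further colours: a colouring
-- of G with the same monomial has a colour class of the same size.
--
-- Positivity of p (Stanley: it counts acyclic orientations with one sink) is
-- obtained from a linear functional φ that picks the coefficient of e_(n): it
-- sends e_(n) to 1 and every e_λ with at least two parts to 0.  It is computed
-- on e_λ and on X_G from the same kind of recurrence, namely the expansion of a
-- series in powers of x₁; for X_G this removes the stable set of vertices of
-- the first colour.

open import Defs
open import Data.Bool.Base using (Bool; true; false; if_then_else_)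
import Data.Empty as Empty
open import Data.Fin.Base using (Fin; zero; suc)
import Data.Fin.Properties as Fin
open import Data.Fin.Subset using (Subset; inside; outside; ∣_∣; ⁅_⁆; _∪_; _─_; ⊥; ⊤; _⊆_) renaming (_∈_ to _∈ˢ_; _∉_ to _∉ˢ_; _-_ to _∖_)
open import Data.Fin.Subset.Properties using (_∈?_; _⊆?_)
import Data.Fin.Subset.Properties as Sub
import Data.Integer.Base as ℤ
import Data.Integer.Properties as ℤ
open import Data.List.Base using (List; []; _∷_; _++_; map; filter; length; upTo; allFin; cartesianProductWith)
import Data.List.Base as List
import Data.List.Properties as List
import Data.List.Extrema.Nat as Extrema
open import Data.List.Membership.Propositional using (_∈_)
import Data.List.Membership.Propositional.Properties as ∈
open import Data.List.Relation.Unary.All using ([]; _∷_)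
import Data.List.Relation.Unary.All as All
open import Data.List.Relation.Unary.Any using (here; there)
open import Data.Maybe.Base as Maybe using (Maybe; just; nothing)
import Data.Maybe.Properties as Maybe
open import Data.Nat.Base as ℕ using (ℕ; zero; suc; s≤s; _∸_; _≥_)
open import Data.Nat.ListAction using (sum)
import Data.Nat.Properties as ℕ
open import Data.Nat.Coprimality as Coprime using (1-coprimeTo)
open import Data.Product.Base using (∃-syntax; _×_; _,_; proj₁; proj₂)
open import Data.Rational.Base using (ℚ; mkℚ; 0ℚ; 1ℚ; _+_; _*_; _-_; -_; _÷_; _/_; _≤_; _<_; Positive; positive; nonNegative)
import Data.Rational.Properties as ℚ
open import Data.Rational.Solver using (module +-*-Solver)
open import Data.Sum.Base using (_⊎_; inj₁; inj₂)
open import Data.Vec.Base as Vec using (Vec; []; _∷_; lookup; tabulate; count; zipWith)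
import Data.Vec.Properties as Vec
import Data.Vec.Relation.Unary.All as VecAll
open import Function.Base using (_∘_; id; const)
open import Function.Bundles using (mk⇔)
open import Relation.Binary.Construct.Closure.ReflexiveTransitive using (Star; ε; _◅_)
open import Relation.Binary.PropositionalEquality using (_≡_; _≢_; refl; sym; trans; cong; cong₂; subst; module ≡-Reasoning)
open import Relation.Nullary.Decidable using (Dec; yes; no; does; ¬?; _×-dec_; _→-dec_; dec-true; dec-false; does-⇔)
open import Relation.Nullary.Negation using (¬_; contradiction)
open import Relation.Unary using (Decidable)

-- The relation `_≥ₑ_` records only q ≢ 0, so the sign of p ÷ q has to come from the graphs. The
-- form of `φ` is explained by F(1ᵏ), a polynomial in k when F is symmetric. For e_λ it is the
-- product of the binomials C(k, λᵢ), each divisible by k, so the linear coefficient vanishes once λ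
-- has two parts. For X_G it is the chromatic polynomial, whose value at -1 and whose linear
-- coefficient count, up to sign, the acyclic orientations and those with one prescribed vertex as
-- only sink. Neither the polynomial nor an orientation is ever built. The signed value at -1 is
-- characterised by Σⱼ (-1)ʲ η(∂ⱼ F) = F(0), which makes it the convolution inverse of F ↦ (-1)^deg
-- F(1); this can be solved inside any family of series closed under ∂ⱼ. The alternating signs are
-- absorbed by inclusion-exclusion over sets of sinks: the resulting numbers `Q` obey a recursion
-- with plus signs only, so their positivity is an induction. Applied to a given expansion, `φ`
-- reads off p for whichever coefficient function witnesses it.

private
  variable
    A B C : Set
    P R : Set

-- Indicators and finite sums of rationals.

⟦_⟧ : Dec P → ℚ
⟦ d ⟧ = if does d then 1ℚ else 0ℚ

⟦⟧-cong : (d : Dec P) (d′ : Dec R) → (P → R) → (R → P) → ⟦ d ⟧ ≡ ⟦ d′ ⟧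
⟦⟧-cong d d′ f g = cong (if_then 1ℚ else 0ℚ) (does-⇔ (mk⇔ f g) d d′)

⟦⟧-yes : (d : Dec P) → P → ⟦ d ⟧ ≡ 1ℚ
⟦⟧-yes d p = cong (if_then 1ℚ else 0ℚ) (dec-true d p)

⟦⟧-no : (d : Dec P) → ¬ P → ⟦ d ⟧ ≡ 0ℚ
⟦⟧-no d ¬p = cong (if_then 1ℚ else 0ℚ) (dec-false d ¬p)

⟦⟧-× : (d : Dec P) (d′ : Dec R) → ⟦ d ×-dec d′ ⟧ ≡ ⟦ d ⟧ * ⟦ d′ ⟧
⟦⟧-× d d′ with does d
... | true  = sym (ℚ.*-identityˡ _)
... | false = sym (ℚ.*-zeroˡ ⟦ d′ ⟧)

⟦⟧-*-cong : (d : Dec P) {x y : ℚ} → (P → x ≡ y) → ⟦ d ⟧ * x ≡ ⟦ d ⟧ * y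
⟦⟧-*-cong (yes p) {x} {y} eq = cong (1ℚ *_) (eq p)
⟦⟧-*-cong (no _)  {x} {y} eq = trans (ℚ.*-zeroˡ x) (sym (ℚ.*-zeroˡ y))

⟦⟧≥0 : (d : Dec P) → 0ℚ ≤ ⟦ d ⟧
⟦⟧≥0 (yes _) = ℚ.nonNegative⁻¹ 1ℚ
⟦⟧≥0 (no _)  = ℚ.≤-refl

Σ[_] : List A → (A → ℚ) → ℚ
Σ[ xs ] f = ∑ (map f xs)

Σ-cong : ∀ (xs : List A) {f g : A → ℚ} → (∀ x → x ∈ xs → f x ≡ g x) → Σ[ xs ] f ≡ Σ[ xs ] g
Σ-cong []       eq = refl
Σ-cong (x ∷ xs) eq = cong₂ _+_ (eq x (here refl)) (Σ-cong xs (λ y → eq y ∘ there))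

Σ-ext : ∀ (xs : List A) {f g : A → ℚ} → (∀ x → f x ≡ g x) → Σ[ xs ] f ≡ Σ[ xs ] g
Σ-ext xs eq = Σ-cong xs (λ x _ → eq x)

Σ-zero : ∀ (xs : List A) {f : A → ℚ} → (∀ x → x ∈ xs → f x ≡ 0ℚ) → Σ[ xs ] f ≡ 0ℚ
Σ-zero []       eq = refl
Σ-zero (x ∷ xs) eq = cong₂ _+_ (eq x (here refl)) (Σ-zero xs (λ y → eq y ∘ there))

+-interchange : ∀ a b c d → (a + b) + (c + d) ≡ (a + c) + (b + d)
+-interchange = solve 4 (λ a b c d → (a :+ b) :+ (c :+ d) := (a :+ c) :+ (b :+ d)) refl
  where open +-*-Solver

*-left-comm : ∀ a b c → a * (b * c) ≡ b * (a * c)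
*-left-comm = solve 3 (λ a b c → a :* (b :* c) := b :* (a :* c)) refl
  where open +-*-Solver

Σ-+ : ∀ (xs : List A) (f g : A → ℚ) → Σ[ xs ] (λ x → f x + g x) ≡ Σ[ xs ] f + Σ[ xs ] g
Σ-+ []       f g = refl
Σ-+ (x ∷ xs) f g = trans (cong ((f x + g x) +_) (Σ-+ xs f g)) (+-interchange (f x) (g x) (Σ[ xs ] f) (Σ[ xs ] g))

Σ-* : ∀ (xs : List A) (c : ℚ) (f : A → ℚ) → Σ[ xs ] (λ x → c * f x) ≡ c * Σ[ xs ] f
Σ-* []       c f = sym (ℚ.*-zeroʳ c)
Σ-* (x ∷ xs) c f = trans (cong (c * f x +_) (Σ-* xs c f)) (sym (ℚ.*-distribˡ-+ c (f x) (Σ[ xs ] f)))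

Σ-neg : ∀ (xs : List A) (f : A → ℚ) → Σ[ xs ] (λ x → - f x) ≡ - Σ[ xs ] f
Σ-neg []       f = refl
Σ-neg (x ∷ xs) f = trans (cong (- f x +_) (Σ-neg xs f)) (sym (ℚ.neg-distrib-+ (f x) (Σ[ xs ] f)))

Σ-swap : ∀ (xs : List A) (ys : List B) (f : A → B → ℚ) →
         Σ[ xs ] (λ x → Σ[ ys ] (f x)) ≡ Σ[ ys ] (λ y → Σ[ xs ] (λ x → f x y))
Σ-swap []       ys f = sym (Σ-zero ys (λ _ _ → refl))
Σ-swap (x ∷ xs) ys f = trans (cong (Σ[ ys ] (f x) +_) (Σ-swap xs ys f))
                             (sym (Σ-+ ys (f x) (λ y → Σ[ xs ] (λ x′ → f x′ y))))

Σ-++ : ∀ (xs ys : List A) (f : A → ℚ) → Σ[ xs ++ ys ] f ≡ Σ[ xs ] f + Σ[ ys ] f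
Σ-++ []       ys f = sym (ℚ.+-identityˡ _)
Σ-++ (x ∷ xs) ys f = trans (cong (f x +_) (Σ-++ xs ys f)) (sym (ℚ.+-assoc (f x) _ _))

Σ-map : ∀ (h : A → B) (xs : List A) (f : B → ℚ) → Σ[ map h xs ] f ≡ Σ[ xs ] (f ∘ h)
Σ-map h xs f = cong ∑ (sym (List.map-∘ xs))

Σ-× : ∀ (h : A → B → C) (xs : List A) (ys : List B) (f : C → ℚ) →
      Σ[ cartesianProductWith h xs ys ] f ≡ Σ[ xs ] (λ x → Σ[ ys ] (λ y → f (h x y)))
Σ-× h []       ys f = refl
Σ-× h (x ∷ xs) ys f = trans (Σ-++ (map (h x) ys) _ f) (cong₂ _+_ (Σ-map (h x) ys f) (Σ-× h xs ys f))

Σ-filter : ∀ {Q : A → Set} (Q? : Decidable Q) (xs : List A) (f : A → ℚ) →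
           Σ[ filter Q? xs ] f ≡ Σ[ xs ] (λ x → ⟦ Q? x ⟧ * f x)
Σ-filter Q? []       f = refl
Σ-filter Q? (x ∷ xs) f with does (Q? x)
... | true  = cong₂ _+_ (sym (ℚ.*-identityˡ (f x))) (Σ-filter Q? xs f)
... | false = trans (Σ-filter Q? xs f) (trans (sym (ℚ.+-identityˡ _)) (cong (_+ _) (sym (ℚ.*-zeroˡ (f x)))))

Σ≥0 : ∀ (xs : List A) {f : A → ℚ} → (∀ x → x ∈ xs → 0ℚ ≤ f x) → 0ℚ ≤ Σ[ xs ] f
Σ≥0 []       f≥0 = ℚ.≤-refl
Σ≥0 (x ∷ xs) f≥0 = ℚ.+-mono-≤ (f≥0 x (here refl)) (Σ≥0 xs (λ y → f≥0 y ∘ there))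

Σ≤0 : ∀ (xs : List A) {f : A → ℚ} → (∀ x → x ∈ xs → f x ≤ 0ℚ) → Σ[ xs ] f ≤ 0ℚ
Σ≤0 []       f≤0 = ℚ.≤-refl
Σ≤0 (x ∷ xs) f≤0 = ℚ.+-mono-≤ (f≤0 x (here refl)) (Σ≤0 xs (λ y → f≤0 y ∘ there))

Σ>0 : ∀ {xs : List A} {f : A → ℚ} {y} → y ∈ xs → (∀ x → x ∈ xs → 0ℚ ≤ f x) → 0ℚ < f y → 0ℚ < Σ[ xs ] f
Σ>0 {xs = x ∷ xs} (here refl) f≥0 f>0 = ℚ.+-mono-<-≤ f>0 (Σ≥0 xs (λ y → f≥0 y ∘ there))
Σ>0 {xs = x ∷ xs} (there y∈)  f≥0 f>0 = ℚ.+-mono-≤-< (f≥0 x (here refl)) (Σ>0 y∈ (λ y → f≥0 y ∘ there) f>0)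

*≥0 : ∀ {p q} → 0ℚ ≤ p → 0ℚ ≤ q → 0ℚ ≤ p * q
*≥0 {p} {q} p≥0 q≥0 = ℚ.nonNegative⁻¹ (p * q) {{ℚ.nonNeg*nonNeg⇒nonNeg p {{nonNegative p≥0}} q {{nonNegative q≥0}}}}

Σ-allFin-suc : ∀ n (f : Fin (suc n) → ℚ) → Σ[ allFin (suc n) ] f ≡ f zero + Σ[ allFin n ] (f ∘ suc)
Σ-allFin-suc n f = cong (λ xs → f zero + ∑ xs) (trans (List.map-tabulate suc f) (sym (List.map-tabulate id (f ∘ suc))))

Σ-upTo-suc : ∀ n (f : ℕ → ℚ) → Σ[ upTo (suc n) ] f ≡ f 0 + Σ[ upTo n ] (f ∘ suc)
Σ-upTo-suc n f = cong (λ xs → f 0 + ∑ xs) (trans (List.map-applyUpTo suc f n) (sym (List.map-applyUpTo id (f ∘ suc) n)))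

Σ-upTo-δ : ∀ {n j} → j ℕ.< n → (f : ℕ → ℚ) → Σ[ upTo n ] (λ k → ⟦ j ℕ.≟ k ⟧ * f k) ≡ f j
Σ-upTo-δ {suc n} {zero} _ f = begin
  Σ[ upTo (suc n) ] (λ k → ⟦ 0 ℕ.≟ k ⟧ * f k)              ≡⟨ Σ-upTo-suc n (λ k → ⟦ 0 ℕ.≟ k ⟧ * f k) ⟩
  1ℚ * f 0 + Σ[ upTo n ] (λ k → 0ℚ * f (suc k))            ≡⟨ cong₂ _+_ (ℚ.*-identityˡ (f 0)) (Σ-zero (upTo n) (λ k _ → ℚ.*-zeroˡ (f (suc k)))) ⟩
  f 0 + 0ℚ                                                  ≡⟨ ℚ.+-identityʳ (f 0) ⟩
  f 0                                                       ∎
  where open ≡-Reasoning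
Σ-upTo-δ {suc n} {suc j} (s≤s j<n) f = begin
  Σ[ upTo (suc n) ] (λ k → ⟦ suc j ℕ.≟ k ⟧ * f k)                      ≡⟨ Σ-upTo-suc n (λ k → ⟦ suc j ℕ.≟ k ⟧ * f k) ⟩
  0ℚ * f 0 + Σ[ upTo n ] (λ k → ⟦ suc j ℕ.≟ suc k ⟧ * f (suc k))       ≡⟨ cong₂ _+_ (ℚ.*-zeroˡ (f 0)) (Σ-upTo-δ j<n (f ∘ suc)) ⟩
  0ℚ + f (suc j)                                                        ≡⟨ ℚ.+-identityˡ (f (suc j)) ⟩
  f (suc j)                                                             ∎
  where open ≡-Reasoning

ι : ℕ → ℚ
ι k = ℤ.+ k / 1

ι-suc : ∀ k → ι (suc k) ≡ 1ℚ + ι k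
ι-suc k = begin
  ι (suc k)                            ≡⟨ cong (λ m → (ℤ.+ suc m) / 1) (sym (ℕ.*-identityʳ k)) ⟩
  ℤ.+ suc (k ℕ.* 1) / 1                ≡⟨ cong (λ z → (ℤ.+ 1 ℤ.+ z) / 1) (ℤ.pos-* k 1) ⟩
  -- `ι k` is stuck on a gcd for a variable `k`; with the literal fraction `mkℚ` in its place the
  -- sum unfolds to the previous line.
  1ℚ + mkℚ (ℤ.+ k) 0 (Coprime.sym (1-coprimeTo k))  ≡⟨ cong (1ℚ +_) (ℚ.normalize-coprime (Coprime.sym (1-coprimeTo k))) ⟨
  1ℚ + ι k                             ∎
  where open ≡-Reasoning

-- The functionals `η` and `φ`, and their evaluation along a recurrence in x₁.

sgn : ℕ → ℚ
sgn zero    = 1ℚ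
sgn (suc k) = - sgn k

-- This is δ₀ - `sgn`. Moving the j = 0 term of Σⱼ (-1)ʲ η(∂ⱼ F) = F(0) to one side turns the
-- equation into a recursion for η(F) with weights `w`; since `w 0` is 0, the recursion only meets
-- series of smaller degree.
w : ℕ → ℚ
w zero    = 0ℚ
w (suc k) = sgn k

sgn≡δ-w : ∀ k → sgn k ≡ ⟦ k ℕ.≟ 0 ⟧ - w k
sgn≡δ-w zero    = refl
sgn≡δ-w (suc k) = sym (ℚ.+-identityˡ (- sgn k))

-- The coefficient of x₁ᵏ as a series in the remaining variables; on symmetric functions this is
-- skewing by the complete homogeneous h_k.
∂ : ℕ → PowerSeries → PowerSeries
∂ k F N a = F (suc N) (k ∷ a)

module Functional (n : ℕ) where

  -- For F symmetric and homogeneous of degree n, η n F and φ F are up to sign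
  -- the value at −1 and n times the linear coefficient of the polynomial
  -- k ↦ F(1ᵏ).

  η : ℕ → PowerSeries → ℚ
  η zero    F = F 0 []
  η (suc f) F = F 0 [] + Σ[ upTo (suc n) ] (λ k → w k * η f (∂ k F))

  -- The weight is a parameter so that one evaluation lemma serves both the recursive part of `η`
  -- (weight `w`) and `φ` (weight k · w k, which differentiates at x₁ = -1).
  Ψ : (ℕ → ℚ) → ℕ → PowerSeries → ℚ
  Ψ v f F = Σ[ upTo (suc n) ] (λ k → v k * η f (∂ k F))

  φ : PowerSeries → ℚ
  φ = Ψ (λ k → ι k * w k) n

  η-cong : ∀ f {F F′ : PowerSeries} → (∀ N a → F N a ≡ F′ N a) → η f F ≡ η f F′
  η-cong zero    eq = eq 0 []
  η-cong (suc f) eq = cong₂ _+_ (eq 0 [])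
    (Σ-ext (upTo (suc n)) (λ k → cong (w k *_) (η-cong f (λ N a → eq (suc N) (k ∷ a)))))

  private
    Σ-Σ-* : ∀ (xs : List A) (c : A → ℚ) (ks : List B) (v : B → ℚ) (g : A → B → ℚ) →
            Σ[ ks ] (λ k → v k * Σ[ xs ] (λ x → c x * g x k)) ≡ Σ[ xs ] (λ x → c x * Σ[ ks ] (λ k → v k * g x k))
    Σ-Σ-* xs c ks v g = begin
      Σ[ ks ] (λ k → v k * Σ[ xs ] (λ x → c x * g x k))      ≡⟨ Σ-ext ks (λ k → Σ-* xs (v k) (λ x → c x * g x k)) ⟨
      Σ[ ks ] (λ k → Σ[ xs ] (λ x → v k * (c x * g x k)))    ≡⟨ Σ-swap ks xs _ ⟩
      Σ[ xs ] (λ x → Σ[ ks ] (λ k → v k * (c x * g x k)))    ≡⟨ Σ-ext xs (λ x → Σ-ext ks (λ k → *-left-comm (v k) (c x) (g x k))) ⟩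
      Σ[ xs ] (λ x → Σ[ ks ] (λ k → c x * (v k * g x k)))    ≡⟨ Σ-ext xs (λ x → Σ-* ks (c x) (λ k → v k * g x k)) ⟩
      Σ[ xs ] (λ x → c x * Σ[ ks ] (λ k → v k * g x k))      ∎
      where open ≡-Reasoning

  η-Σ : ∀ f (xs : List A) (c : A → ℚ) (F : A → PowerSeries) →
        η f (λ N a → Σ[ xs ] (λ x → c x * F x N a)) ≡ Σ[ xs ] (λ x → c x * η f (F x))
  η-Σ zero    xs c F = refl
  η-Σ (suc f) xs c F = begin
    Σ[ xs ] (λ x → c x * F x 0 []) + Σ[ ks ] (λ k → w k * η f (λ N a → Σ[ xs ] (λ x → c x * ∂ k (F x) N a)))
      ≡⟨ cong (F₀ +_) (Σ-ext ks (λ k → cong (w k *_) (η-Σ f xs c (∂ k ∘ F)))) ⟩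
    Σ[ xs ] (λ x → c x * F x 0 []) + Σ[ ks ] (λ k → w k * Σ[ xs ] (λ x → c x * η f (∂ k (F x))))
      ≡⟨ cong (F₀ +_) (Σ-Σ-* xs c ks w (λ x k → η f (∂ k (F x)))) ⟩
    Σ[ xs ] (λ x → c x * F x 0 []) + Σ[ xs ] (λ x → c x * Σ[ ks ] (λ k → w k * η f (∂ k (F x))))
      ≡⟨ Σ-+ xs _ _ ⟨
    Σ[ xs ] (λ x → c x * F x 0 [] + c x * Σ[ ks ] (λ k → w k * η f (∂ k (F x))))
      ≡⟨ Σ-ext xs (λ x → ℚ.*-distribˡ-+ (c x) _ _) ⟨
    Σ[ xs ] (λ x → c x * η (suc f) (F x)) ∎
    where
      open ≡-Reasoning
      ks = upTo (suc n)
      F₀ = Σ[ xs ] (λ x → c x * F x 0 [])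

  φ-cong : ∀ {F F′ : PowerSeries} → (∀ N a → F N a ≡ F′ N a) → φ F ≡ φ F′
  φ-cong eq = Σ-ext (upTo (suc n)) (λ k → cong (ι k * w k *_) (η-cong n (λ N a → eq (suc N) (k ∷ a))))

  φ-Σ : ∀ (xs : List A) (c : A → ℚ) (F : A → PowerSeries) →
        φ (λ N a → Σ[ xs ] (λ x → c x * F x N a)) ≡ Σ[ xs ] (λ x → c x * φ (F x))
  φ-Σ xs c F = trans
    (Σ-ext (upTo (suc n)) (λ k → cong (ι k * w k *_) (η-Σ n xs c (∂ k ∘ F))))
    (Σ-Σ-* xs c (upTo (suc n)) (λ k → ι k * w k) (λ x k → η n (∂ k (F x))))

-- The data needed to evaluate `η` and `φ` on a family of series closed under `∂`. An entry (j , t)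
-- of `step s` stands for the summand x₁ʲ · `series t`, with repetitions counted. `step-0` says that
-- removing no power of x₁ leads back to `s` alone; it is phrased through an arbitrary `g` to be
-- usable directly under a sum. `step-deg` makes degrees drop by exactly j, which drives all
-- inductions below.
record Recurrence : Set₁ where
  field
    State  : Set
    deg    : State → ℕ
    step   : State → List (ℕ × State)
    series : State → PowerSeries

    series-∷ : ∀ s k N a → series s (suc N) (k ∷ a) ≡
               Σ[ step s ] (λ (j , t) → ⟦ j ℕ.≟ k ⟧ * series t N a)
    step-0   : ∀ s (g : State → ℚ) → Σ[ step s ] (λ (j , t) → ⟦ j ℕ.≟ 0 ⟧ * g t) ≡ g s
    step-deg : ∀ s {j t} → (j , t) ∈ step s → j ℕ.+ deg t ≡ deg s

module _ (n : ℕ) (𝓡 : Recurrence) where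
  open Recurrence 𝓡
  open Functional n

  -- No exponent j of a step exceeds `deg s`, hence none exceeds n, so the sum over k ≤ n meets
  -- every step exactly once, at k = j.
  Ψ-series : ∀ v f s → deg s ℕ.≤ n →
             Ψ v f (series s) ≡ Σ[ step s ] (λ (j , t) → v j * η f (series t))
  Ψ-series v f s s≤n = begin
    Σ[ ks ] (λ k → v k * η f (∂ k (series s)))
      ≡⟨ Σ-ext ks (λ k → cong (v k *_) (trans (η-cong f (series-∷ s k)) (η-Σ f (step s) (λ (j , _) → ⟦ j ℕ.≟ k ⟧) (series ∘ proj₂)))) ⟩
    Σ[ ks ] (λ k → v k * Σ[ step s ] (λ (j , t) → ⟦ j ℕ.≟ k ⟧ * η f (series t)))
      ≡⟨ Σ-ext ks (λ k → Σ-* (step s) (v k) _) ⟨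
    Σ[ ks ] (λ k → Σ[ step s ] (λ (j , t) → v k * (⟦ j ℕ.≟ k ⟧ * η f (series t))))
      ≡⟨ Σ-swap ks (step s) _ ⟩
    Σ[ step s ] (λ (j , t) → Σ[ ks ] (λ k → v k * (⟦ j ℕ.≟ k ⟧ * η f (series t))))
      ≡⟨ Σ-cong (step s) (λ (j , t) jt∈ → trans
           (Σ-ext ks (λ k → *-left-comm (v k) ⟦ j ℕ.≟ k ⟧ (η f (series t))))
           (Σ-upTo-δ (s≤s (ℕ.≤-trans (ℕ.m≤m+n j (deg t)) (ℕ.≤-trans (ℕ.≤-reflexive (step-deg s jt∈)) s≤n)))
                     (λ k → v k * η f (series t)))) ⟩
    Σ[ step s ] (λ (j , t) → v j * η f (series t)) ∎
    where
      open ≡-Reasoning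
      ks = upTo (suc n)

  -- The argument `f` is fuel. Steps with j = 0 have weight 0 and all others lower the degree, so
  -- fuel equal to the degree already gives the final value.
  η-stable : ∀ f s → deg s ℕ.≤ f → f ℕ.≤ n → η (suc f) (series s) ≡ η f (series s)
  η-stable zero s s≤f f≤n = begin
    series s 0 [] + Ψ w 0 (series s)                            ≡⟨ cong (series s 0 [] +_) (Ψ-series w 0 s (ℕ.≤-trans s≤f f≤n)) ⟩
    series s 0 [] + Σ[ step s ] (λ (j , t) → w j * η 0 (series t)) ≡⟨ cong (series s 0 [] +_) (Σ-zero (step s) (λ (j , t) jt∈ → vanish j t (step-deg s jt∈))) ⟩
    series s 0 [] + 0ℚ                                          ≡⟨ ℚ.+-identityʳ _ ⟩
    series s 0 []                                               ∎
    where
      open ≡-Reasoning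
      vanish : ∀ j t → j ℕ.+ deg t ≡ deg s → w j * η 0 (series t) ≡ 0ℚ
      vanish zero    t _  = ℚ.*-zeroˡ (η 0 (series t))
      vanish (suc j) t eq = contradiction (ℕ.≤-trans (ℕ.≤-reflexive eq) s≤f) λ ()
  η-stable (suc f) s s≤f f≤n = cong (series s 0 [] +_) (begin
    Ψ w (suc f) (series s)                                    ≡⟨ Ψ-series w (suc f) s (ℕ.≤-trans s≤f f≤n) ⟩
    Σ[ step s ] (λ (j , t) → w j * η (suc f) (series t))      ≡⟨ Σ-cong (step s) (λ (j , t) jt∈ → lower j t (step-deg s jt∈)) ⟩
    Σ[ step s ] (λ (j , t) → w j * η f (series t))            ≡⟨ Ψ-series w f s (ℕ.≤-trans s≤f f≤n) ⟨
    Ψ w f (series s)                                          ∎)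
    where
      open ≡-Reasoning
      lower : ∀ j t → j ℕ.+ deg t ≡ deg s → w j * η (suc f) (series t) ≡ w j * η f (series t)
      lower zero    t _  = trans (ℚ.*-zeroˡ (η (suc f) (series t))) (sym (ℚ.*-zeroˡ (η f (series t))))
      lower (suc j) t eq = cong (sgn j *_) (η-stable f t
        (ℕ.≤-trans (ℕ.m≤n+m (deg t) j) (ℕ.s≤s⁻¹ (ℕ.≤-trans (ℕ.≤-reflexive eq) s≤f))) (ℕ.<⇒≤ f≤n))

  -- By `sgn≡δ-w` the sum is η(s) minus the recursive part of η(s), which leaves the constant term.
  -- Stability supplies the extra unit of fuel that exposes the recursion.
  η-inverse : ∀ s → deg s ℕ.≤ n → Σ[ step s ] (λ (j , t) → sgn j * η n (series t)) ≡ series s 0 []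
  η-inverse s s≤n = begin
    Σ[ step s ] (λ (j , t) → sgn j * h t)
      ≡⟨ Σ-ext (step s) (λ (j , t) → trans (cong (_* h t) (sgn≡δ-w j)) (split ⟦ j ℕ.≟ 0 ⟧ (w j) (h t))) ⟩
    Σ[ step s ] (λ (j , t) → ⟦ j ℕ.≟ 0 ⟧ * h t + - (w j * h t))
      ≡⟨ Σ-+ (step s) _ _ ⟩
    Σ[ step s ] (λ (j , t) → ⟦ j ℕ.≟ 0 ⟧ * h t) + Σ[ step s ] (λ (j , t) → - (w j * h t))
      ≡⟨ cong₂ _+_ (step-0 s h) (Σ-neg (step s) _) ⟩
    h s - Σ[ step s ] (λ (j , t) → w j * h t)
      ≡⟨ cong₂ _-_ (sym (η-stable n s s≤n ℕ.≤-refl)) (sym (Ψ-series w n s s≤n)) ⟩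
    series s 0 [] + Ψ w n (series s) - Ψ w n (series s)
      ≡⟨ cancel (series s 0 []) (Ψ w n (series s)) ⟩
    series s 0 [] ∎
    where
      open ≡-Reasoning
      open +-*-Solver using (solve; _:+_; _:*_; _:-_; :-_; _:=_)
      h : State → ℚ
      h t = η n (series t)
      split : ∀ a b c → (a - b) * c ≡ a * c + - (b * c)
      split = solve 3 (λ a b c → (a :- b) :* c := a :* c :+ :- (b :* c)) refl
      cancel : ∀ a b → a + b - b ≡ a
      cancel = solve 2 (λ a b → a :+ b :- b := a) refl

  -- The j = 0 steps contribute `g s` with coefficient 1 and the others involve smaller degrees, so
  -- the equation of `η-inverse` determines its solution. Guessing a solution therefore computes
  -- `η`.
  η-unique : (g : State → ℚ) → (∀ s → Σ[ step s ] (λ (j , t) → sgn j * g t) ≡ series s 0 []) →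
             ∀ f s → deg s ℕ.≤ f → f ℕ.≤ n → η f (series s) ≡ g s
  η-unique g g-inverse zero s s≤f f≤n = begin
    series s 0 []                                        ≡⟨ g-inverse s ⟨
    Σ[ step s ] (λ (j , t) → sgn j * g t)                ≡⟨ Σ-cong (step s) (λ (j , t) jt∈ → only-0 j t (step-deg s jt∈)) ⟩
    Σ[ step s ] (λ (j , t) → ⟦ j ℕ.≟ 0 ⟧ * g t)          ≡⟨ step-0 s g ⟩
    g s                                                  ∎
    where
      open ≡-Reasoning
      only-0 : ∀ j t → j ℕ.+ deg t ≡ deg s → sgn j * g t ≡ ⟦ j ℕ.≟ 0 ⟧ * g t
      only-0 zero    t _  = refl
      only-0 (suc j) t eq = contradiction (ℕ.≤-trans (ℕ.≤-reflexive eq) s≤f) λ ()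
  η-unique g g-inverse (suc f) s s≤f f≤n = begin
    series s 0 [] + Ψ w f (series s)
      ≡⟨ cong₂ _+_ (sym (g-inverse s)) (Ψ-series w f s (ℕ.≤-trans s≤f f≤n)) ⟩
    Σ[ step s ] (λ (j , t) → sgn j * g t) + Σ[ step s ] (λ (j , t) → w j * η f (series t))
      ≡⟨ Σ-+ (step s) _ _ ⟨
    Σ[ step s ] (λ (j , t) → sgn j * g t + w j * η f (series t))
      ≡⟨ Σ-cong (step s) (λ (j , t) jt∈ → merge j t (step-deg s jt∈)) ⟩
    Σ[ step s ] (λ (j , t) → ⟦ j ℕ.≟ 0 ⟧ * g t)
      ≡⟨ step-0 s g ⟩
    g s ∎
    where
      open ≡-Reasoning
      merge : ∀ j t → j ℕ.+ deg t ≡ deg s → sgn j * g t + w j * η f (series t) ≡ ⟦ j ℕ.≟ 0 ⟧ * g t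
      merge zero    t _  = trans (cong (1ℚ * g t +_) (ℚ.*-zeroˡ (η f (series t)))) (ℚ.+-identityʳ (1ℚ * g t))
      merge (suc j) t eq = begin
        - sgn j * g t + sgn j * η f (series t)  ≡⟨ cong (λ x → - sgn j * g t + sgn j * x) (η-unique g g-inverse f t
                                                     (ℕ.≤-trans (ℕ.m≤n+m (deg t) j) (ℕ.s≤s⁻¹ (ℕ.≤-trans (ℕ.≤-reflexive eq) s≤f))) (ℕ.<⇒≤ f≤n)) ⟩
        - sgn j * g t + sgn j * g t             ≡⟨ cancel (sgn j) (g t) ⟩
        0ℚ                                      ≡⟨ ℚ.*-zeroˡ (g t) ⟨
        0ℚ * g t                                ∎
        where
          open +-*-Solver using (solve; _:+_; _:*_; :-_; _:=_; con)
          cancel : ∀ a b → - a * b + a * b ≡ 0ℚ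
          cancel = solve 2 (λ a b → :- a :* b :+ a :* b := con 0ℚ) refl

-- The recurrence of the products of elementary symmetric functions

⊛-∷ : ∀ (F F′ : PowerSeries) k {N} (a : Vec ℕ N) →
      (F ⊛ F′) (suc N) (k ∷ a) ≡ Σ[ upTo (suc k) ] (λ i → (∂ i F ⊛ ∂ (k ∸ i) F′) N a)
⊛-∷ F F′ k {N} a =
  Σ-× _∷_ (upTo (suc k)) (below a) (λ b → F (suc N) b * F′ (suc N) (zipWith _∸_ (k ∷ a) b))

⊛-zeroˡ : ∀ (F F′ : PowerSeries) {N} (a : Vec ℕ N) → (∀ b → F N b ≡ 0ℚ) → (F ⊛ F′) N a ≡ 0ℚ
⊛-zeroˡ F F′ {N} a F≡0 = Σ-zero (below a) (λ b _ → trans (cong (_* F′ N (zipWith _∸_ a b)) (F≡0 b)) (ℚ.*-zeroˡ (F′ N (zipWith _∸_ a b))))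

⊛-congʳ : ∀ (F : PowerSeries) {F′ F″ : PowerSeries} {N} (a : Vec ℕ N) → (∀ b → F′ N b ≡ F″ N b) →
          (F ⊛ F′) N a ≡ (F ⊛ F″) N a
⊛-congʳ F a eq = Σ-ext (below a) (λ b → cong (F _ b *_) (eq (zipWith _∸_ a b)))

⊛-Σ : ∀ (F : PowerSeries) (xs : List A) (c : A → ℚ) (F′ : A → PowerSeries) {N} (a : Vec ℕ N) →
      (F ⊛ (λ N b → Σ[ xs ] (λ x → c x * F′ x N b))) N a ≡ Σ[ xs ] (λ x → c x * (F ⊛ F′ x) N a)
⊛-Σ F xs c F′ {N} a = begin
  Σ[ below a ] (λ b → F N b * Σ[ xs ] (λ x → c x * G x b))    ≡⟨ Σ-ext (below a) (λ b → Σ-* xs (F N b) (λ x → c x * G x b)) ⟨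
  Σ[ below a ] (λ b → Σ[ xs ] (λ x → F N b * (c x * G x b)))  ≡⟨ Σ-swap (below a) xs _ ⟩
  Σ[ xs ] (λ x → Σ[ below a ] (λ b → F N b * (c x * G x b)))  ≡⟨ Σ-ext xs (λ x → Σ-ext (below a) (λ b → *-left-comm (F N b) (c x) (G x b))) ⟩
  Σ[ xs ] (λ x → Σ[ below a ] (λ b → c x * (F N b * G x b)))  ≡⟨ Σ-ext xs (λ x → Σ-* (below a) (c x) (λ b → F N b * G x b)) ⟩
  Σ[ xs ] (λ x → c x * (F ⊛ F′ x) N a)                        ∎
  where
    open ≡-Reasoning
    G : _ → _ → ℚ
    G x b = F′ x N (zipWith _∸_ a b)

⊛≥0 : ∀ {F F′ : PowerSeries} → (∀ N a → 0ℚ ≤ F N a) → (∀ N a → 0ℚ ≤ F′ N a) → ∀ N a → 0ℚ ≤ (F ⊛ F′) N a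
⊛≥0 F≥0 F′≥0 N a = Σ≥0 (below a) (λ b _ → *≥0 (F≥0 N b) (F′≥0 N (zipWith _∸_ a b)))

e≥0 : ∀ k N a → 0ℚ ≤ e k N a
e≥0 k N a = ⟦⟧≥0 (VecAll.all? (ℕ._≤? 1) a ×-dec (Vec.sum a ℕ.≟ k))

e[]≥0 : ∀ λs N a → 0ℚ ≤ e[ λs ] N a
e[]≥0 []       = e≥0 0
e[]≥0 (k ∷ λs) = ⊛≥0 {e k} {e[ λs ]} (e≥0 k) (e[]≥0 λs)

e-0-suc : ∀ k {N} (a : Vec ℕ N) → ∂ (suc k) (e 0) N a ≡ 0ℚ
e-0-suc k a = ⟦⟧-no (VecAll.all? (ℕ._≤? 1) (suc k ∷ a) ×-dec (Vec.sum (suc k ∷ a) ℕ.≟ 0)) λ ()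

⊛-∷-e-0 : ∀ F k {N} (a : Vec ℕ N) → (e 0 ⊛ F) (suc N) (k ∷ a) ≡ (e 0 ⊛ ∂ k F) N a
⊛-∷-e-0 F k {N} a = begin
  (e 0 ⊛ F) (suc N) (k ∷ a)                             ≡⟨ ⊛-∷ (e 0) F k a ⟩
  Σ[ upTo (suc k) ] h                                   ≡⟨ Σ-upTo-suc k h ⟩
  h 0 + Σ[ upTo k ] (h ∘ suc)                           ≡⟨ cong (h 0 +_) (Σ-zero (upTo k) (λ i _ → ⊛-zeroˡ (∂ (suc i) (e 0)) (∂ (k ∸ suc i) F) a (e-0-suc i))) ⟩
  h 0 + 0ℚ                                              ≡⟨ ℚ.+-identityʳ (h 0) ⟩
  h 0                                                   ∎
  where
    open ≡-Reasoning
    h : ℕ → ℚ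
    h i = (∂ i (e 0) ⊛ ∂ (k ∸ i) F) N a

⊛-∷-e-suc-0 : ∀ F m {N} (a : Vec ℕ N) → (e (suc m) ⊛ F) (suc N) (0 ∷ a) ≡ (e (suc m) ⊛ ∂ 0 F) N a
⊛-∷-e-suc-0 F m a = trans (⊛-∷ (e (suc m)) F 0 a) (ℚ.+-identityʳ _)

-- As a polynomial in x₁, e_{m+1} is linear, with constant part e_{m+1} and leading part e_m in the
-- other variables; only two summands of the Cauchy product survive.
⊛-∷-e-suc-suc : ∀ F m k {N} (a : Vec ℕ N) →
                (e (suc m) ⊛ F) (suc N) (suc k ∷ a) ≡ (e (suc m) ⊛ ∂ (suc k) F) N a + (e m ⊛ ∂ k F) N a
⊛-∷-e-suc-suc F m k {N} a = begin
  (e (suc m) ⊛ F) (suc N) (suc k ∷ a)                   ≡⟨ ⊛-∷ (e (suc m)) F (suc k) a ⟩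
  Σ[ upTo (2 ℕ.+ k) ] h                                 ≡⟨ Σ-upTo-suc (suc k) h ⟩
  h 0 + Σ[ upTo (suc k) ] (h ∘ suc)                     ≡⟨ cong (h 0 +_) (Σ-upTo-suc k (h ∘ suc)) ⟩
  h 0 + (h 1 + Σ[ upTo k ] (λ i → h (2 ℕ.+ i)))             ≡⟨ cong (λ x → h 0 + (h 1 + x)) (Σ-zero (upTo k) (λ i _ → ⊛-zeroˡ (∂ (2 ℕ.+ i) (e (suc m))) (∂ (k ∸ suc i) F) a (e-≥2 i))) ⟩
  h 0 + (h 1 + 0ℚ)                                      ≡⟨ cong (h 0 +_) (ℚ.+-identityʳ (h 1)) ⟩
  h 0 + h 1                                             ∎
  where
    open ≡-Reasoning
    h : ℕ → ℚ
    h i = (∂ i (e (suc m)) ⊛ ∂ (suc k ∸ i) F) N a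
    e-≥2 : ∀ i (b : Vec ℕ N) → ∂ (2 ℕ.+ i) (e (suc m)) N b ≡ 0ℚ
    e-≥2 i b = ⟦⟧-no (VecAll.all? (ℕ._≤? 1) (2 ℕ.+ i ∷ b) ×-dec (Vec.sum (2 ℕ.+ i ∷ b) ℕ.≟ suc m))
                     λ { (s≤s () VecAll.∷ _ , _) }

-- Expands the product of the factors e_m + x₁ e_{m-1} over the parts m: each positive part either
-- stays or gives one unit to x₁. Parts that reach 0 stay in the list, as factors e₀ = 1.
stepₑ : List ℕ → List (ℕ × List ℕ)
stepₑ []           = (0 , []) ∷ []
stepₑ (zero  ∷ λs) = map (λ (j , t) → j , 0 ∷ t) (stepₑ λs)
stepₑ (suc m ∷ λs) = map (λ (j , t) → j , suc m ∷ t) (stepₑ λs) ++ map (λ (j , t) → suc j , m ∷ t) (stepₑ λs)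

Σ-stepₑ-suc : ∀ m λs (f : ℕ × List ℕ → ℚ) → Σ[ stepₑ (suc m ∷ λs) ] f ≡
              Σ[ stepₑ λs ] (λ (j , t) → f (j , suc m ∷ t)) + Σ[ stepₑ λs ] (λ (j , t) → f (suc j , m ∷ t))
Σ-stepₑ-suc m λs f = trans (Σ-++ (map _ (stepₑ λs)) _ f) (cong₂ _+_ (Σ-map _ (stepₑ λs) f) (Σ-map _ (stepₑ λs) f))

⊛-stepₑ : ∀ F k λs {N} (a : Vec ℕ N) →
          (∀ b → ∂ k e[ λs ] N b ≡ Σ[ stepₑ λs ] (λ (j , t) → ⟦ j ℕ.≟ k ⟧ * e[ t ] N b)) →
          (F ⊛ ∂ k e[ λs ]) N a ≡ Σ[ stepₑ λs ] (λ (j , t) → ⟦ j ℕ.≟ k ⟧ * (F ⊛ e[ t ]) N a)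
⊛-stepₑ F k λs a eq = trans
  (⊛-congʳ F {∂ k e[ λs ]} {λ N b → Σ[ stepₑ λs ] (λ (j , t) → ⟦ j ℕ.≟ k ⟧ * e[ t ] N b)} a eq)
  (⊛-Σ F (stepₑ λs) (λ (j , _) → ⟦ j ℕ.≟ k ⟧) (λ (_ , t) → e[ t ]) a)

stepₑ-∷ : ∀ s k N a → e[ s ] (suc N) (k ∷ a) ≡ Σ[ stepₑ s ] (λ (j , t) → ⟦ j ℕ.≟ k ⟧ * e[ t ] N a)
stepₑ-∷ [] zero N a = sym (trans (ℚ.+-identityʳ _) (ℚ.*-identityˡ (e 0 N a)))
stepₑ-∷ [] (suc k) N a = trans (e-0-suc k a) (sym (trans (ℚ.+-identityʳ _) (ℚ.*-zeroˡ (e 0 N a))))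
stepₑ-∷ (zero ∷ λs) k N a = begin
  (e 0 ⊛ e[ λs ]) (suc N) (k ∷ a)                                       ≡⟨ ⊛-∷-e-0 e[ λs ] k a ⟩
  (e 0 ⊛ ∂ k e[ λs ]) N a                                               ≡⟨ ⊛-stepₑ (e 0) k λs a (stepₑ-∷ λs k N) ⟩
  Σ[ stepₑ λs ] (λ (j , t) → ⟦ j ℕ.≟ k ⟧ * e[ 0 ∷ t ] N a)              ≡⟨ Σ-map _ (stepₑ λs) _ ⟨
  Σ[ stepₑ (0 ∷ λs) ] (λ (j , t) → ⟦ j ℕ.≟ k ⟧ * e[ t ] N a)            ∎
  where open ≡-Reasoning
stepₑ-∷ (suc m ∷ λs) zero N a = begin
  (e (suc m) ⊛ e[ λs ]) (suc N) (0 ∷ a)                                 ≡⟨ ⊛-∷-e-suc-0 e[ λs ] m a ⟩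
  (e (suc m) ⊛ ∂ 0 e[ λs ]) N a                                         ≡⟨ ⊛-stepₑ (e (suc m)) 0 λs a (stepₑ-∷ λs 0 N) ⟩
  x                                                                     ≡⟨ ℚ.+-identityʳ x ⟨
  x + 0ℚ                                                                ≡⟨ cong (x +_) (Σ-zero (stepₑ λs) (λ (j , t) _ → ℚ.*-zeroˡ (e[ m ∷ t ] N a))) ⟨
  x + Σ[ stepₑ λs ] (λ (j , t) → 0ℚ * e[ m ∷ t ] N a)                   ≡⟨ Σ-stepₑ-suc m λs (λ (j , t) → ⟦ j ℕ.≟ 0 ⟧ * e[ t ] N a) ⟨
  Σ[ stepₑ (suc m ∷ λs) ] (λ (j , t) → ⟦ j ℕ.≟ 0 ⟧ * e[ t ] N a)        ∎
  where
    open ≡-Reasoning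
    x = Σ[ stepₑ λs ] (λ (j , t) → ⟦ j ℕ.≟ 0 ⟧ * e[ suc m ∷ t ] N a)
stepₑ-∷ (suc m ∷ λs) (suc k) N a = begin
  (e (suc m) ⊛ e[ λs ]) (suc N) (suc k ∷ a)                             ≡⟨ ⊛-∷-e-suc-suc e[ λs ] m k a ⟩
  (e (suc m) ⊛ ∂ (suc k) e[ λs ]) N a + (e m ⊛ ∂ k e[ λs ]) N a         ≡⟨ cong₂ _+_ (expand (suc m) (suc k)) (expand m k) ⟩
  Σ[ stepₑ λs ] (λ (j , t) → ⟦ j ℕ.≟ suc k ⟧ * e[ suc m ∷ t ] N a) +
  Σ[ stepₑ λs ] (λ (j , t) → ⟦ j ℕ.≟ k ⟧ * e[ m ∷ t ] N a)              ≡⟨ Σ-stepₑ-suc m λs (λ (j , t) → ⟦ j ℕ.≟ suc k ⟧ * e[ t ] N a) ⟨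
  Σ[ stepₑ (suc m ∷ λs) ] (λ (j , t) → ⟦ j ℕ.≟ suc k ⟧ * e[ t ] N a)    ∎
  where
    open ≡-Reasoning
    expand : ∀ l i → (e l ⊛ ∂ i e[ λs ]) N a ≡ Σ[ stepₑ λs ] (λ (j , t) → ⟦ j ℕ.≟ i ⟧ * e[ l ∷ t ] N a)
    expand l i = ⊛-stepₑ (e l) i λs a (stepₑ-∷ λs i N)

stepₑ-0 : ∀ s (g : List ℕ → ℚ) → Σ[ stepₑ s ] (λ (j , t) → ⟦ j ℕ.≟ 0 ⟧ * g t) ≡ g s
stepₑ-0 []           g = trans (ℚ.+-identityʳ _) (ℚ.*-identityˡ (g []))
stepₑ-0 (zero  ∷ λs) g = trans (Σ-map _ (stepₑ λs) _) (stepₑ-0 λs (g ∘ (0 ∷_)))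
stepₑ-0 (suc m ∷ λs) g = trans (Σ-stepₑ-suc m λs (λ (j , t) → ⟦ j ℕ.≟ 0 ⟧ * g t))
  (trans (cong₂ _+_ (stepₑ-0 λs (g ∘ (suc m ∷_))) (Σ-zero (stepₑ λs) (λ (j , t) _ → ℚ.*-zeroˡ (g (m ∷ t)))))
         (ℚ.+-identityʳ (g (suc m ∷ λs))))

stepₑ-deg : ∀ s {j t} → (j , t) ∈ stepₑ s → j ℕ.+ sum t ≡ sum s
stepₑ-deg [] (here refl) = refl
stepₑ-deg (zero ∷ λs) jt∈ with _ , jt∈′ , refl ← ∈.∈-map⁻ _ jt∈ = stepₑ-deg λs jt∈′
stepₑ-deg (suc m ∷ λs) jt∈ with ∈.∈-++⁻ (map _ (stepₑ λs)) jt∈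
... | inj₁ l with (j , t) , jt∈′ , refl ← ∈.∈-map⁻ _ l =
  trans (ℕ-left-comm j (suc m) (sum t)) (cong (suc m ℕ.+_) (stepₑ-deg λs jt∈′))
  where
    ℕ-left-comm : ∀ a b c → a ℕ.+ (b ℕ.+ c) ≡ b ℕ.+ (a ℕ.+ c)
    ℕ-left-comm a b c = trans (sym (ℕ.+-assoc a b c)) (trans (cong (ℕ._+ c) (ℕ.+-comm a b)) (ℕ.+-assoc b a c))
... | inj₂ r with (j , t) , jt∈′ , refl ← ∈.∈-map⁻ _ r =
  cong suc (trans (sym (ℕ.+-assoc j m (sum t))) (trans (cong (ℕ._+ sum t) (ℕ.+-comm j m)) (trans (ℕ.+-assoc m j (sum t)) (cong (m ℕ.+_) (stepₑ-deg λs jt∈′)))))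

e-recurrence : Recurrence
e-recurrence = record
  { State = List ℕ ; deg = sum ; step = stepₑ ; series = e[_]
  ; series-∷ = stepₑ-∷ ; step-0 = stepₑ-0 ; step-deg = stepₑ-deg }

-- Makes the constant 1 a solution for `η-unique`, so η(e_λ) = 1. With r positive parts the
-- exponents j are distributed as in (1 + t)ʳ, which at t = -1 is 0 unless r = 0.
Σ-sgn-stepₑ : ∀ s → Σ[ stepₑ s ] (λ (j , t) → sgn j * 1ℚ) ≡ e[ s ] 0 []
Σ-sgn-stepₑ [] = refl
Σ-sgn-stepₑ (zero ∷ λs) = begin
  Σ[ stepₑ (0 ∷ λs) ] (λ (j , t) → sgn j * 1ℚ)  ≡⟨ Σ-map _ (stepₑ λs) _ ⟩
  Σ[ stepₑ λs ] (λ (j , t) → sgn j * 1ℚ)        ≡⟨ Σ-sgn-stepₑ λs ⟩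
  e[ λs ] 0 []                                  ≡⟨ ℚ.*-identityˡ _ ⟨
  1ℚ * e[ λs ] 0 []                             ≡⟨ ℚ.+-identityʳ _ ⟨
  1ℚ * e[ λs ] 0 [] + 0ℚ                        ∎
  where open ≡-Reasoning
Σ-sgn-stepₑ (suc m ∷ λs) = begin
  Σ[ stepₑ (suc m ∷ λs) ] (λ (j , t) → sgn j * 1ℚ)  ≡⟨ Σ-stepₑ-suc m λs (λ (j , t) → sgn j * 1ℚ) ⟩
  x + Σ[ stepₑ λs ] (λ (j , t) → - sgn j * 1ℚ)      ≡⟨ cong (x +_) (Σ-ext (stepₑ λs) (λ (j , t) → ℚ.neg-distribˡ-* (sgn j) 1ℚ)) ⟨
  x + Σ[ stepₑ λs ] (λ (j , t) → - (sgn j * 1ℚ))    ≡⟨ cong (x +_) (Σ-neg (stepₑ λs) _) ⟩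
  x - x                                             ≡⟨ ℚ.+-inverseʳ x ⟩
  0ℚ                                                ≡⟨ ℚ.*-zeroˡ (e[ λs ] 0 []) ⟨
  0ℚ * e[ λs ] 0 []                                 ≡⟨ ℚ.+-identityʳ _ ⟨
  0ℚ * e[ λs ] 0 [] + 0ℚ                            ∎
  where
    open ≡-Reasoning
    x = Σ[ stepₑ λs ] (λ (j , t) → sgn j * 1ℚ)

ι*w : ∀ j → ι j * w j ≡ - (ι j * sgn j)
ι*w zero    = refl
ι*w (suc j) = solve 2 (λ i s → i :* s := :- (i :* :- s)) refl (ι (suc j)) (sgn j)
  where open +-*-Solver using (solve; _:*_; :-_; _:=_)

-- The weight j · w j is the derivative of tʲ at t = -1. By the product rule the derivative of (1 +
-- t)(1 + t)ʳ there is 0ʳ, where r counts the positive parts of `λs`.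
Σ-ι*w-stepₑ-suc : ∀ m λs → Σ[ stepₑ (suc m ∷ λs) ] (λ (j , t) → ι j * w j * 1ℚ) ≡ e[ λs ] 0 []
Σ-ι*w-stepₑ-suc m λs = begin
  Σ[ stepₑ (suc m ∷ λs) ] (λ (j , t) → ι j * w j * 1ℚ)
    ≡⟨ Σ-stepₑ-suc m λs (λ (j , t) → ι j * w j * 1ℚ) ⟩
  Σ[ stepₑ λs ] (λ (j , t) → ι j * w j * 1ℚ) + Σ[ stepₑ λs ] (λ (j , t) → ι (suc j) * sgn j * 1ℚ)
    ≡⟨ Σ-+ (stepₑ λs) _ _ ⟨
  Σ[ stepₑ λs ] (λ (j , t) → ι j * w j * 1ℚ + ι (suc j) * sgn j * 1ℚ)
    ≡⟨ Σ-ext (stepₑ λs) (λ (j , t) → trans (cong₂ (λ x y → x * 1ℚ + y * sgn j * 1ℚ) (ι*w j) (ι-suc j)) (collapse (ι j) (sgn j))) ⟩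
  Σ[ stepₑ λs ] (λ (j , t) → sgn j * 1ℚ)
    ≡⟨ Σ-sgn-stepₑ λs ⟩
  e[ λs ] 0 [] ∎
  where
    open ≡-Reasoning
    open +-*-Solver using (solve; _:+_; _:*_; :-_; _:=_; con)
    collapse : ∀ i s → - (i * s) * 1ℚ + (1ℚ + i) * s * 1ℚ ≡ s * 1ℚ
    collapse = solve 2 (λ i s → :- (i :* s) :* con 1ℚ :+ (con 1ℚ :+ i) :* s :* con 1ℚ := s :* con 1ℚ) refl

module _ (n : ℕ) where
  open Functional n

  -- The right side is 1 for empty `λs` and 0 as soon as `λs` has a positive part, so among
  -- partitions of n only (n) is seen.
  φ-e : ∀ m λs → sum (suc m ∷ λs) ℕ.≤ n → φ e[ suc m ∷ λs ] ≡ e[ λs ] 0 []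
  φ-e m λs ≤n = begin
    φ e[ suc m ∷ λs ]
      ≡⟨ Ψ-series n e-recurrence (λ k → ι k * w k) n (suc m ∷ λs) ≤n ⟩
    Σ[ stepₑ (suc m ∷ λs) ] (λ (j , t) → ι j * w j * η n e[ t ])
      ≡⟨ Σ-cong (stepₑ (suc m ∷ λs)) (λ (j , t) jt∈ → cong (ι j * w j *_)
           (η-unique n e-recurrence (const 1ℚ) Σ-sgn-stepₑ n t
             (ℕ.≤-trans (ℕ.m≤n+m (sum t) j) (ℕ.≤-trans (ℕ.≤-reflexive (stepₑ-deg (suc m ∷ λs) jt∈)) ≤n)) ℕ.≤-refl)) ⟩
    Σ[ stepₑ (suc m ∷ λs) ] (λ (j , t) → ι j * w j * 1ℚ)
      ≡⟨ Σ-ι*w-stepₑ-suc m λs ⟩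
    e[ λs ] 0 [] ∎
    where open ≡-Reasoning

-- The recurrence of the chromatic symmetric functions of the induced subgraphs

subsets : ∀ n → List (Subset n)
subsets = sequences (inside ∷ outside ∷ [])

Σ-subsets-suc : ∀ n (f : Subset (suc n) → ℚ) →
                Σ[ subsets (suc n) ] f ≡ Σ[ subsets n ] (f ∘ (inside ∷_)) + Σ[ subsets n ] (f ∘ (outside ∷_))
Σ-subsets-suc n f = trans (Σ-× _∷_ (inside ∷ outside ∷ []) (subsets n) f) (cong (Σ[ subsets n ] (f ∘ (inside ∷_)) +_) (ℚ.+-identityʳ _))

Σ-subsets-∅ : ∀ n (f : Subset n → ℚ) → Σ[ subsets n ] (λ S → ⟦ ∣ S ∣ ℕ.≟ 0 ⟧ * f S) ≡ f ⊥
Σ-subsets-∅ zero    f = trans (ℚ.+-identityʳ _) (ℚ.*-identityˡ (f []))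
Σ-subsets-∅ (suc n) f = begin
  Σ[ subsets (suc n) ] (λ S → ⟦ ∣ S ∣ ℕ.≟ 0 ⟧ * f S)  ≡⟨ Σ-subsets-suc n (λ S → ⟦ ∣ S ∣ ℕ.≟ 0 ⟧ * f S) ⟩
  Σ[ subsets n ] (λ S → 0ℚ * f (inside ∷ S)) + Σ[ subsets n ] (λ S → ⟦ ∣ S ∣ ℕ.≟ 0 ⟧ * f (outside ∷ S))
    ≡⟨ cong₂ _+_ (Σ-zero (subsets n) (λ S _ → ℚ.*-zeroˡ (f (inside ∷ S)))) (Σ-subsets-∅ n (f ∘ (outside ∷_))) ⟩
  0ℚ + f ⊥                                            ≡⟨ ℚ.+-identityˡ (f ⊥) ⟩
  f ⊥                                                 ∎
  where open ≡-Reasoning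

∣─∣ : ∀ {n} (S U : Subset n) → S ⊆ U → ∣ S ∣ ℕ.+ ∣ U ─ S ∣ ≡ ∣ U ∣
∣─∣ []            []            _   = refl
∣─∣ (inside ∷ S)  (inside ∷ U)  S⊆U = cong suc (∣─∣ S U (Sub.drop-∷-⊆ S⊆U))
∣─∣ (inside ∷ S)  (outside ∷ U) S⊆U with () ← S⊆U Vec.here
∣─∣ (outside ∷ S) (outside ∷ U) S⊆U = ∣─∣ S U (Sub.drop-∷-⊆ S⊆U)
∣─∣ (outside ∷ S) (inside ∷ U)  S⊆U = trans (ℕ.+-suc ∣ S ∣ ∣ U ─ S ∣) (cong suc (∣─∣ S U (Sub.drop-∷-⊆ S⊆U)))

-- Partial colourings: the vertices outside U get the value nothing.

colourings : ∀ N {n} → Subset n → List (Vec (Maybe (Fin N)) n)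
colourings N []            = [] ∷ []
colourings N (outside ∷ U) = map (nothing ∷_) (colourings N U)
colourings N (inside ∷ U)  = cartesianProductWith (λ i κ → just i ∷ κ) (allFin N) (colourings N U)

mark : ∀ {N} → Bool → Maybe (Fin N) → Maybe (Fin (suc N))
mark inside  _ = just zero
mark outside c = Maybe.map suc c

merge : ∀ {N n} → Subset n → Vec (Maybe (Fin N)) n → Vec (Maybe (Fin (suc N))) n
merge = zipWith mark

-- A colouring is determined by its class `S` of colour zero and a colouring of `U ─ S` with the
-- other colours shifted down. The condition S ⊆ U is kept as an indicator over all subsets, so that
-- the induction can follow the vector `U` entry by entry.
Σ-colourings-suc : ∀ N {n} (U : Subset n) (f : Vec (Maybe (Fin (suc N))) n → ℚ) →
                   Σ[ colourings (suc N) U ] f ≡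
                   Σ[ subsets n ] (λ S → ⟦ S ⊆? U ⟧ * Σ[ colourings N (U ─ S) ] (f ∘ merge S))
Σ-colourings-suc N [] f = sym (trans (ℚ.+-identityʳ _) (ℚ.*-identityˡ _))
Σ-colourings-suc N {suc n} (outside ∷ U) f = begin
  Σ[ colourings (suc N) (outside ∷ U) ] f                         ≡⟨ Σ-map (nothing ∷_) (colourings (suc N) U) f ⟩
  Σ[ colourings (suc N) U ] (f ∘ (nothing ∷_))                    ≡⟨ Σ-colourings-suc N U (f ∘ (nothing ∷_)) ⟩
  Σ[ subsets n ] (λ S → ⟦ S ⊆? U ⟧ * Σ[ colourings N (U ─ S) ] (f ∘ (nothing ∷_) ∘ merge S))
    ≡⟨ Σ-ext (subsets n) (λ S → cong (⟦ S ⊆? U ⟧ *_) (Σ-map (nothing ∷_) (colourings N (U ─ S)) (f ∘ merge (outside ∷ S)))) ⟨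
  Σ[ subsets n ] (h ∘ (outside ∷_))                               ≡⟨ ℚ.+-identityˡ _ ⟨
  0ℚ + Σ[ subsets n ] (h ∘ (outside ∷_))
    ≡⟨ cong (_+ Σ[ subsets n ] (h ∘ (outside ∷_))) (Σ-zero (subsets n) (λ S _ → ℚ.*-zeroˡ (Σ[ colourings N (outside ∷ (U ─ S)) ] (f ∘ merge (inside ∷ S))))) ⟨
  Σ[ subsets n ] (h ∘ (inside ∷_)) + Σ[ subsets n ] (h ∘ (outside ∷_))  ≡⟨ Σ-subsets-suc n h ⟨
  Σ[ subsets (suc n) ] h                                          ∎
  where
    open ≡-Reasoning
    h : Subset (suc n) → ℚ
    h S = ⟦ S ⊆? (outside ∷ U) ⟧ * Σ[ colourings N ((outside ∷ U) ─ S) ] (f ∘ merge S)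
Σ-colourings-suc N {suc n} (inside ∷ U) f = begin
  Σ[ colourings (suc N) (inside ∷ U) ] f
    ≡⟨ Σ-× (λ i κ → just i ∷ κ) (allFin (suc N)) (colourings (suc N) U) f ⟩
  Σ[ allFin (suc N) ] (λ i → Σ[ colourings (suc N) U ] (λ κ → f (just i ∷ κ)))
    ≡⟨ Σ-ext (allFin (suc N)) (λ i → Σ-colourings-suc N U (λ κ → f (just i ∷ κ))) ⟩
  Σ[ allFin (suc N) ] g
    ≡⟨ Σ-allFin-suc N g ⟩
  g zero + Σ[ allFin N ] (g ∘ suc)
    ≡⟨ cong₂ _+_ coloured others ⟩
  Σ[ subsets n ] (h ∘ (inside ∷_)) + Σ[ subsets n ] (h ∘ (outside ∷_))
    ≡⟨ Σ-subsets-suc n h ⟨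
  Σ[ subsets (suc n) ] h ∎
  where
    open ≡-Reasoning
    h : Subset (suc n) → ℚ
    h S = ⟦ S ⊆? (inside ∷ U) ⟧ * Σ[ colourings N ((inside ∷ U) ─ S) ] (f ∘ merge S)
    g : Fin (suc N) → ℚ
    g i = Σ[ subsets n ] (λ S → ⟦ S ⊆? U ⟧ * Σ[ colourings N (U ─ S) ] (λ κ → f (just i ∷ merge S κ)))
    coloured : g zero ≡ Σ[ subsets n ] (h ∘ (inside ∷_))
    coloured = Σ-ext (subsets n) (λ S → cong (⟦ S ⊆? U ⟧ *_)
      (sym (Σ-map (nothing ∷_) (colourings N (U ─ S)) (f ∘ merge (inside ∷ S)))))
    others : Σ[ allFin N ] (g ∘ suc) ≡ Σ[ subsets n ] (h ∘ (outside ∷_))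
    others = begin
      Σ[ allFin N ] (g ∘ suc)
        ≡⟨ Σ-swap (allFin N) (subsets n) _ ⟩
      Σ[ subsets n ] (λ S → Σ[ allFin N ] (λ i → ⟦ S ⊆? U ⟧ * Σ[ colourings N (U ─ S) ] (λ κ → f (just (suc i) ∷ merge S κ))))
        ≡⟨ Σ-ext (subsets n) (λ S → Σ-* (allFin N) ⟦ S ⊆? U ⟧ _) ⟩
      Σ[ subsets n ] (λ S → ⟦ S ⊆? U ⟧ * Σ[ allFin N ] (λ i → Σ[ colourings N (U ─ S) ] (λ κ → f (just (suc i) ∷ merge S κ))))
        ≡⟨ Σ-ext (subsets n) (λ S → cong (⟦ S ⊆? U ⟧ *_) (Σ-× (λ i κ → just i ∷ κ) (allFin N) (colourings N (U ─ S)) (f ∘ merge (outside ∷ S)))) ⟨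
      Σ[ subsets n ] (h ∘ (outside ∷_)) ∎

-- `merge S` overwrites whatever κ says on `S`. This condition, that κ is uncoloured there, makes
-- contents and properness of the merged colouring determine those of κ.
data Off {N} : ∀ {n} → Subset n → Vec (Maybe (Fin N)) n → Set where
  []   : Off [] []
  off∷ : ∀ {n} {S : Subset n} {κ} → Off S κ → Off (inside ∷ S) (nothing ∷ κ)
  any∷ : ∀ {n} {S : Subset n} {κ c} → Off S κ → Off (outside ∷ S) (c ∷ κ)

colourings-off : ∀ {N n} (U S : Subset n) {κ} → κ ∈ colourings N (U ─ S) → Off S κ
colourings-off [] [] (here refl) = []
colourings-off (_ ∷ U) (inside ∷ S) κ∈ with _ , κ∈′ , refl ← ∈.∈-map⁻ _ κ∈ = off∷ (colourings-off U S κ∈′)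
colourings-off (outside ∷ U) (outside ∷ S) κ∈ with _ , κ∈′ , refl ← ∈.∈-map⁻ _ κ∈ = any∷ (colourings-off U S κ∈′)
colourings-off {N} (inside ∷ U) (outside ∷ S) κ∈
  with _ , _ , _ , κ∈′ , refl ← ∈.∈-cartesianProductWith⁻ _ (allFin N) (colourings N (U ─ S)) κ∈ = any∷ (colourings-off U S κ∈′)

off-lookup : ∀ {N n} {S : Subset n} {κ : Vec (Maybe (Fin N)) n} → Off S κ → ∀ {u} → u ∈ˢ S → lookup κ u ≡ nothing
off-lookup (off∷ o) Vec.here        = refl
off-lookup (off∷ o) (Vec.there u∈S) = off-lookup o u∈S
off-lookup (any∷ o) (Vec.there u∈S) = off-lookup o u∈S

colour? : ∀ {N} (i : Fin N) → Decidable (just i ≡_)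
colour? i = Maybe.≡-dec Fin._≟_ (just i)

content′ : ∀ {N n} → Vec (Maybe (Fin N)) n → Vec ℕ N
content′ κ = tabulate (λ i → count (colour? i) κ)

count-merge-zero : ∀ {N n} (S : Subset n) (κ : Vec (Maybe (Fin N)) n) → count (colour? zero) (merge S κ) ≡ ∣ S ∣
count-merge-zero []            []            = refl
count-merge-zero (inside ∷ S)  (_ ∷ κ)       = cong suc (count-merge-zero S κ)
count-merge-zero (outside ∷ S) (nothing ∷ κ) = count-merge-zero S κ
count-merge-zero (outside ∷ S) (just _ ∷ κ)  = count-merge-zero S κ

count-merge-suc : ∀ {N n} (i : Fin N) {S : Subset n} {κ} → Off S κ → count (colour? (suc i)) (merge S κ) ≡ count (colour? i) κ
count-merge-suc i []                       = refl
count-merge-suc i (off∷ o)                 = count-merge-suc i o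
count-merge-suc i (any∷ {c = nothing} o)   = count-merge-suc i o
count-merge-suc i (any∷ {c = just j} o) with does (i Fin.≟ j)
... | true  = cong suc (count-merge-suc i o)
... | false = count-merge-suc i o

content-merge : ∀ {N n} {S : Subset n} {κ : Vec (Maybe (Fin N)) n} → Off S κ → content′ (merge S κ) ≡ ∣ S ∣ ∷ content′ κ
content-merge {S = S} {κ} o = cong₂ _∷_ (count-merge-zero S κ) (Vec.tabulate-cong (λ i → count-merge-suc i o))

-- Uncoloured vertices never clash, not even with each other, so properness of a partial colouring
-- only tests edges between coloured vertices.
Clash : ∀ {N} → Maybe (Fin N) → Maybe (Fin N) → Set
Clash (just i) (just j) = i ≡ j
Clash _        _        = Empty.⊥

clash? : ∀ {N} (c d : Maybe (Fin N)) → Dec (Clash c d)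
clash? (just i) (just j) = i Fin.≟ j
clash? (just _) nothing  = no λ ()
clash? nothing  _        = no λ ()

module Restrict {n} (G : Graph n) where
  open Graph G

  Proper′ : ∀ {N} → Vec (Maybe (Fin N)) n → Set
  Proper′ κ = ∀ u v → u ~ v → ¬ Clash (lookup κ u) (lookup κ v)

  proper′? : ∀ {N} (κ : Vec (Maybe (Fin N)) n) → Dec (Proper′ κ)
  proper′? κ = Fin.all? λ u → Fin.all? λ v → (u ~? v) →-dec ¬? (clash? (lookup κ u) (lookup κ v))

  merge-proper⁺ : ∀ {N} (S : Subset n) {κ : Vec (Maybe (Fin N)) n} → Stable G S → Proper′ κ → Proper′ (merge S κ)
  merge-proper⁺ S {κ} stable proper u v u~v clash
    rewrite Vec.lookup-zipWith mark u S κ | Vec.lookup-zipWith mark v S κ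
    with lookup S u in Su | lookup S v in Sv
  ... | inside  | inside  = stable u (Vec.lookup⇒[]= u S Su) v (Vec.lookup⇒[]= v S Sv) u~v
  ... | inside  | outside with lookup κ v
  ...   | just _  with () ← clash
  ...   | nothing with () ← clash
  merge-proper⁺ S {κ} stable proper u v u~v clash | outside | inside with lookup κ u
  ...   | just _  with () ← clash
  ...   | nothing with () ← clash
  merge-proper⁺ S {κ} stable proper u v u~v clash | outside | outside
    with lookup κ u | lookup κ v | proper u v u~v
  ...   | just _  | just _  | ¬clash = ¬clash (Fin.suc-injective clash)
  ...   | just _  | nothing | _ with () ← clash
  ...   | nothing | just _  | _ with () ← clash
  ...   | nothing | nothing | _ with () ← clash

  merge-proper⁻ : ∀ {N} (S : Subset n) {κ : Vec (Maybe (Fin N)) n} → Off S κ → Proper′ (merge S κ) → Stable G S × Proper′ κ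
  merge-proper⁻ S {κ} o proper = stable , proper-κ
    where
    proper-marks : ∀ u v → u ~ v → ¬ Clash (mark (lookup S u) (lookup κ u)) (mark (lookup S v) (lookup κ v))
    proper-marks u v u~v rewrite sym (Vec.lookup-zipWith mark u S κ) | sym (Vec.lookup-zipWith mark v S κ) = proper u v u~v
    stable : Stable G S
    stable u u∈S v v∈S u~v with lookup S u | lookup S v | Vec.[]=⇒lookup u∈S | Vec.[]=⇒lookup v∈S | proper-marks u v u~v
    ... | _ | _ | refl | refl | ¬clash = ¬clash refl
    proper-κ : Proper′ κ
    proper-κ u v u~v clash with lookup S u in Su | lookup S v in Sv | proper-marks u v u~v
    ... | inside | _ | _ rewrite off-lookup o (Vec.lookup⇒[]= u S Su) = clash
    ... | outside | inside | _ rewrite off-lookup o (Vec.lookup⇒[]= v S Sv) with lookup κ u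
    ...   | just _  = clash
    ...   | nothing = clash
    proper-κ u v u~v clash | outside | outside | ¬clash with lookup κ u | lookup κ v
    ...   | just _ | just _ = ¬clash (cong suc clash)

  -- The chromatic symmetric function of the subgraph induced on U. Keeping `Fin n` as index set
  -- makes removal of vertices an operation on subsets, without renumbering.
  𝒳 : Subset n → PowerSeries
  𝒳 U N a = Σ[ colourings N U ] (λ κ → ⟦ proper′? κ ×-dec Vec.≡-dec ℕ._≟_ (content′ κ) a ⟧)

  Stable⊆ : Subset n → Subset n → Set
  Stable⊆ U S = S ⊆ U × Stable G S

  stable⊆? : ∀ U S → Dec (Stable⊆ U S)
  stable⊆? U S = (S ⊆? U) ×-dec stable? G S

  remove : Subset n → List (ℕ × Subset n)
  remove U = map (λ S → ∣ S ∣ , U ─ S) (filter (stable⊆? U) (subsets n))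

  Σ-remove : ∀ U (f : ℕ × Subset n → ℚ) →
             Σ[ remove U ] f ≡ Σ[ subsets n ] (λ S → ⟦ stable⊆? U S ⟧ * f (∣ S ∣ , U ─ S))
  Σ-remove U f = trans (Σ-map _ (filter (stable⊆? U) (subsets n)) f) (Σ-filter (stable⊆? U) (subsets n) _)

  𝒳-∷ : ∀ U k N a → 𝒳 U (suc N) (k ∷ a) ≡ Σ[ remove U ] (λ (j , U′) → ⟦ j ℕ.≟ k ⟧ * 𝒳 U′ N a)
  𝒳-∷ U k N a = begin
    𝒳 U (suc N) (k ∷ a)
      ≡⟨ Σ-colourings-suc N U f ⟩
    Σ[ subsets n ] (λ S → ⟦ S ⊆? U ⟧ * Σ[ colourings N (U ─ S) ] (f ∘ merge S))
      ≡⟨ Σ-ext (subsets n) (λ S → cong (⟦ S ⊆? U ⟧ *_) (trans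
           (Σ-cong (colourings N (U ─ S)) (λ κ κ∈ → factor S (colourings-off U S κ∈)))
           (trans (Σ-* (colourings N (U ─ S)) ⟦ stable? G S ⟧ _)
                  (cong (⟦ stable? G S ⟧ *_) (Σ-* (colourings N (U ─ S)) ⟦ ∣ S ∣ ℕ.≟ k ⟧ _))))) ⟩
    Σ[ subsets n ] (λ S → ⟦ S ⊆? U ⟧ * (⟦ stable? G S ⟧ * (⟦ ∣ S ∣ ℕ.≟ k ⟧ * 𝒳 (U ─ S) N a)))
      ≡⟨ Σ-ext (subsets n) (λ S → trans (cong (_* (⟦ ∣ S ∣ ℕ.≟ k ⟧ * 𝒳 (U ─ S) N a)) (⟦⟧-× (S ⊆? U) (stable? G S))) (ℚ.*-assoc ⟦ S ⊆? U ⟧ ⟦ stable? G S ⟧ _)) ⟨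
    Σ[ subsets n ] (λ S → ⟦ stable⊆? U S ⟧ * (⟦ ∣ S ∣ ℕ.≟ k ⟧ * 𝒳 (U ─ S) N a))
      ≡⟨ Σ-remove U (λ (j , U′) → ⟦ j ℕ.≟ k ⟧ * 𝒳 U′ N a) ⟨
    Σ[ remove U ] (λ (j , U′) → ⟦ j ℕ.≟ k ⟧ * 𝒳 U′ N a) ∎
    where
      open ≡-Reasoning
      f : Vec (Maybe (Fin (suc N))) n → ℚ
      f κ = ⟦ proper′? κ ×-dec Vec.≡-dec ℕ._≟_ (content′ κ) (k ∷ a) ⟧
      factor : ∀ S {κ} → Off S κ →
               f (merge S κ) ≡ ⟦ stable? G S ⟧ * (⟦ ∣ S ∣ ℕ.≟ k ⟧ * ⟦ proper′? κ ×-dec Vec.≡-dec ℕ._≟_ (content′ κ) a ⟧)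
      factor S {κ} o = begin
        f (merge S κ)
          ≡⟨ ⟦⟧-cong (proper′? (merge S κ) ×-dec Vec.≡-dec ℕ._≟_ (content′ (merge S κ)) (k ∷ a)) (stable? G S ×-dec rest)
               (λ (proper , eq) → let s , p = merge-proper⁻ S o proper
                                      eq₀ , eq₁ = Vec.∷-injective (trans (sym (content-merge o)) eq)
                                  in s , eq₀ , p , eq₁)
               (λ (s , eq₀ , p , eq₁) → merge-proper⁺ S s p , trans (content-merge o) (cong₂ _∷_ eq₀ eq₁)) ⟩
        ⟦ stable? G S ×-dec rest ⟧
          ≡⟨ trans (⟦⟧-× (stable? G S) rest) (cong (⟦ stable? G S ⟧ *_) (⟦⟧-× (∣ S ∣ ℕ.≟ k) (proper′? κ ×-dec Vec.≡-dec ℕ._≟_ (content′ κ) a))) ⟩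
        ⟦ stable? G S ⟧ * (⟦ ∣ S ∣ ℕ.≟ k ⟧ * ⟦ proper′? κ ×-dec Vec.≡-dec ℕ._≟_ (content′ κ) a ⟧) ∎
        where
          rest : Dec (∣ S ∣ ≡ k × (Proper′ κ × content′ κ ≡ a))
          rest = (∣ S ∣ ℕ.≟ k) ×-dec (proper′? κ ×-dec Vec.≡-dec ℕ._≟_ (content′ κ) a)

  stable-⊥ : Stable G ⊥
  stable-⊥ u u∈⊥ = contradiction u∈⊥ Sub.∉⊥

  remove-0 : ∀ U (g : Subset n → ℚ) → Σ[ remove U ] (λ (j , U′) → ⟦ j ℕ.≟ 0 ⟧ * g U′) ≡ g U
  remove-0 U g = begin
    Σ[ remove U ] (λ (j , U′) → ⟦ j ℕ.≟ 0 ⟧ * g U′)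
      ≡⟨ Σ-remove U (λ (j , U′) → ⟦ j ℕ.≟ 0 ⟧ * g U′) ⟩
    Σ[ subsets n ] (λ S → ⟦ stable⊆? U S ⟧ * (⟦ ∣ S ∣ ℕ.≟ 0 ⟧ * g (U ─ S)))
      ≡⟨ Σ-ext (subsets n) (λ S → *-left-comm ⟦ stable⊆? U S ⟧ ⟦ ∣ S ∣ ℕ.≟ 0 ⟧ (g (U ─ S))) ⟩
    Σ[ subsets n ] (λ S → ⟦ ∣ S ∣ ℕ.≟ 0 ⟧ * (⟦ stable⊆? U S ⟧ * g (U ─ S)))
      ≡⟨ Σ-subsets-∅ n (λ S → ⟦ stable⊆? U S ⟧ * g (U ─ S)) ⟩
    ⟦ stable⊆? U ⊥ ⟧ * g (U ─ ⊥)
      ≡⟨ cong₂ _*_ (⟦⟧-yes (stable⊆? U ⊥) (Sub.⊥⊆ , stable-⊥)) (cong g (Sub.p─⊥≡p U)) ⟩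
    1ℚ * g U
      ≡⟨ ℚ.*-identityˡ (g U) ⟩
    g U ∎
    where open ≡-Reasoning

  remove-deg : ∀ U {j U′} → (j , U′) ∈ remove U → j ℕ.+ ∣ U′ ∣ ≡ ∣ U ∣
  remove-deg U ∈remove with S , S∈ , refl ← ∈.∈-map⁻ _ ∈remove =
    ∣─∣ S U (proj₁ (proj₂ (∈.∈-filter⁻ (stable⊆? U) {xs = subsets n} S∈)))

  𝒳-recurrence : Recurrence
  𝒳-recurrence = record
    { State = Subset n ; deg = ∣_∣ ; step = remove ; series = 𝒳
    ; series-∷ = 𝒳-∷ ; step-0 = remove-0 ; step-deg = remove-deg }

  𝒳-⊥ : 𝒳 ⊥ 0 [] ≡ 1ℚ
  𝒳-⊥ = trans
    (cong (λ κs → Σ[ κs ] (λ κ → ⟦ proper′? κ ×-dec Vec.≡-dec ℕ._≟_ (content′ κ) [] ⟧)) (only n))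
    (trans (ℚ.+-identityʳ _) (⟦⟧-yes (proper′? uncoloured ×-dec Vec.≡-dec ℕ._≟_ [] []) (proper , refl)))
    where
    uncoloured : ∀ {n} → Vec (Maybe (Fin 0)) n
    uncoloured = Vec.replicate _ nothing
    only : ∀ n → colourings 0 (⊥ {n}) ≡ uncoloured ∷ []
    only zero    = refl
    only (suc n) = cong (map (nothing ∷_)) (only n)
    proper : Proper′ uncoloured
    proper u v _ clash rewrite Vec.lookup-replicate u (nothing {A = Fin 0}) = clash

  private
    ι-length-filter : ∀ {Q : A → Set} (Q? : Decidable Q) xs → ι (length (filter Q? xs)) ≡ Σ[ xs ] (λ x → ⟦ Q? x ⟧)
    ι-length-filter Q? []       = refl
    ι-length-filter Q? (x ∷ xs) with does (Q? x)
    ... | true  = trans (ι-suc (length (filter Q? xs))) (cong (1ℚ +_) (ι-length-filter Q? xs))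
    ... | false = trans (ι-length-filter Q? xs) (sym (ℚ.+-identityˡ _))

    Σ-colourings-⊤ : ∀ N m (f : Vec (Maybe (Fin N)) m → ℚ) →
                     Σ[ colourings N ⊤ ] f ≡ Σ[ sequences (allFin N) m ] (f ∘ Vec.map just)
    Σ-colourings-⊤ N zero    f = refl
    Σ-colourings-⊤ N (suc m) f = begin
      Σ[ colourings N ⊤ ] f                                                               ≡⟨ Σ-× _ (allFin N) (colourings N ⊤) f ⟩
      Σ[ allFin N ] (λ i → Σ[ colourings N ⊤ ] (λ κ → f (just i ∷ κ)))                    ≡⟨ Σ-ext (allFin N) (λ i → Σ-colourings-⊤ N m (λ κ → f (just i ∷ κ))) ⟩
      Σ[ allFin N ] (λ i → Σ[ sequences (allFin N) m ] (λ κ → f (just i ∷ Vec.map just κ))) ≡⟨ Σ-× _∷_ (allFin N) (sequences (allFin N) m) (f ∘ Vec.map just) ⟨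
      Σ[ sequences (allFin N) (suc m) ] (f ∘ Vec.map just)                                ∎
      where open ≡-Reasoning

    count-map-just : ∀ {N m} (i : Fin N) (κ : Vec (Fin N) m) → count (colour? i) (Vec.map just κ) ≡ count (i Fin.≟_) κ
    count-map-just i []      = refl
    count-map-just i (j ∷ κ) with does (i Fin.≟ j)
    ... | true  = cong suc (count-map-just i κ)
    ... | false = count-map-just i κ

    content-map-just : ∀ {N m} (κ : Vec (Fin N) m) → content′ (Vec.map just κ) ≡ content κ
    content-map-just κ = Vec.tabulate-cong (λ i → count-map-just i κ)

    proper⁻ : ∀ {N} (κ : Vec (Fin N) n) → Proper′ (Vec.map just κ) → Proper G κ
    proper⁻ κ proper u v u~v eq with proper u v u~v
    ... | ¬clash rewrite Vec.lookup-map u just κ | Vec.lookup-map v just κ = ¬clash eq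

    proper⁺ : ∀ {N} (κ : Vec (Fin N) n) → Proper G κ → Proper′ (Vec.map just κ)
    proper⁺ κ proper u v u~v clash rewrite Vec.lookup-map u just κ | Vec.lookup-map v just κ = proper u v u~v clash

  X≡𝒳⊤ : ∀ N a → X G N a ≡ 𝒳 ⊤ N a
  X≡𝒳⊤ N a = begin
    X G N a
      ≡⟨ ι-length-filter (λ κ → proper? G κ ×-dec Vec.≡-dec ℕ._≟_ (content κ) a) κs ⟩
    Σ[ κs ] (λ κ → ⟦ proper? G κ ×-dec Vec.≡-dec ℕ._≟_ (content κ) a ⟧)
      ≡⟨ Σ-ext κs (λ κ → ⟦⟧-cong (proper? G κ ×-dec Vec.≡-dec ℕ._≟_ (content κ) a)
                                  (proper′? (Vec.map just κ) ×-dec Vec.≡-dec ℕ._≟_ (content′ (Vec.map just κ)) a)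
                                  (λ (p , eq) → proper⁺ κ p , trans (content-map-just κ) eq)
                                  (λ (p , eq) → proper⁻ κ p , trans (sym (content-map-just κ)) eq)) ⟩
    Σ[ κs ] (λ κ → ⟦ proper′? (Vec.map just κ) ×-dec Vec.≡-dec ℕ._≟_ (content′ (Vec.map just κ)) a ⟧)
      ≡⟨ Σ-colourings-⊤ N n _ ⟨
    𝒳 ⊤ N a ∎
    where
      open ≡-Reasoning
      κs = sequences (allFin N) n

-- Positivity of φ on connected graphs

∣⁅⁆∪∣ : ∀ {n} {x : Fin n} {S} → x ∉ˢ S → ∣ ⁅ x ⁆ ∪ S ∣ ≡ suc ∣ S ∣
∣⁅⁆∪∣ {x = zero}  {inside ∷ S}  x∉S = contradiction Vec.here x∉S
∣⁅⁆∪∣ {x = zero}  {outside ∷ S} x∉S = cong (suc ∘ ∣_∣) (Sub.∪-identityˡ S)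
∣⁅⁆∪∣ {x = suc x} {inside ∷ S}  x∉S = cong suc (∣⁅⁆∪∣ (x∉S ∘ Vec.there))
∣⁅⁆∪∣ {x = suc x} {outside ∷ S} x∉S = ∣⁅⁆∪∣ (x∉S ∘ Vec.there)

x∉p∖x : ∀ {n} (x : Fin n) {p} → x ∉ˢ p ∖ x
x∉p∖x zero    {_ ∷ _} ()
x∉p∖x (suc x) {_ ∷ _} (Vec.there x∈) = x∉p∖x x x∈

_∉?_ : ∀ {n} (x : Fin n) S → Dec (x ∉ˢ S)
x ∉? S = ¬? (x ∈? S)

Σ-subsets-split : ∀ {n} (x : Fin n) (f : Subset n → ℚ) → Σ[ subsets n ] f ≡
                  Σ[ subsets n ] (λ S → ⟦ x ∉? S ⟧ * f S) + Σ[ subsets n ] (λ S → ⟦ x ∉? S ⟧ * f (⁅ x ⁆ ∪ S))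
Σ-subsets-split {suc n} zero f = begin
  Σ[ subsets (suc n) ] f
    ≡⟨ Σ-subsets-suc n f ⟩
  Σ[ subsets n ] (f ∘ (inside ∷_)) + Σ[ subsets n ] (f ∘ (outside ∷_))
    ≡⟨ ℚ.+-comm (Σ[ subsets n ] (f ∘ (inside ∷_))) _ ⟩
  Σ[ subsets n ] (f ∘ (outside ∷_)) + Σ[ subsets n ] (f ∘ (inside ∷_))
    ≡⟨ cong₂ _+_ (only-outside f) (trans (Σ-ext (subsets n) (λ S → cong (f ∘ (inside ∷_)) (sym (Sub.∪-identityˡ S)))) (only-outside (f ∘ (⁅ zero ⁆ ∪_)))) ⟩
  Σ[ subsets (suc n) ] (λ S → ⟦ zero ∉? S ⟧ * f S) + Σ[ subsets (suc n) ] (λ S → ⟦ zero ∉? S ⟧ * f (⁅ zero ⁆ ∪ S)) ∎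
  where
    open ≡-Reasoning
    only-outside : (h : Subset (suc n) → ℚ) → Σ[ subsets n ] (h ∘ (outside ∷_)) ≡ Σ[ subsets (suc n) ] (λ S → ⟦ zero ∉? S ⟧ * h S)
    only-outside h = begin
      Σ[ subsets n ] (h ∘ (outside ∷_))
        ≡⟨ ℚ.+-identityˡ _ ⟨
      0ℚ + Σ[ subsets n ] (h ∘ (outside ∷_))
        ≡⟨ cong₂ _+_ (Σ-zero (subsets n) (λ S _ → ℚ.*-zeroˡ (h (inside ∷ S)))) (Σ-ext (subsets n) (λ S → ℚ.*-identityˡ (h (outside ∷ S)))) ⟨
      Σ[ subsets n ] (λ S → 0ℚ * h (inside ∷ S)) + Σ[ subsets n ] (λ S → 1ℚ * h (outside ∷ S))
        ≡⟨ Σ-subsets-suc n (λ S → ⟦ zero ∉? S ⟧ * h S) ⟨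
      Σ[ subsets (suc n) ] (λ S → ⟦ zero ∉? S ⟧ * h S) ∎
Σ-subsets-split {suc n} (suc x) f = begin
  Σ[ subsets (suc n) ] f
    ≡⟨ Σ-subsets-suc n f ⟩
  Σ[ subsets n ] (f ∘ (inside ∷_)) + Σ[ subsets n ] (f ∘ (outside ∷_))
    ≡⟨ cong₂ _+_ (Σ-subsets-split x (f ∘ (inside ∷_))) (Σ-subsets-split x (f ∘ (outside ∷_))) ⟩
  (a + b) + (c + d)
    ≡⟨ +-interchange a b c d ⟩
  (a + c) + (b + d)
    ≡⟨ cong₂ _+_ (Σ-subsets-suc n (λ S → ⟦ suc x ∉? S ⟧ * f S)) (Σ-subsets-suc n (λ S → ⟦ suc x ∉? S ⟧ * f (⁅ suc x ⁆ ∪ S))) ⟨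
  Σ[ subsets (suc n) ] (λ S → ⟦ suc x ∉? S ⟧ * f S) + Σ[ subsets (suc n) ] (λ S → ⟦ suc x ∉? S ⟧ * f (⁅ suc x ⁆ ∪ S)) ∎
  where
    open ≡-Reasoning
    a = Σ[ subsets n ] (λ S → ⟦ x ∉? S ⟧ * f (inside ∷ S))
    b = Σ[ subsets n ] (λ S → ⟦ x ∉? S ⟧ * f (inside ∷ (⁅ x ⁆ ∪ S)))
    c = Σ[ subsets n ] (λ S → ⟦ x ∉? S ⟧ * f (outside ∷ S))
    d = Σ[ subsets n ] (λ S → ⟦ x ∉? S ⟧ * f (outside ∷ (⁅ x ⁆ ∪ S)))

ι-∣∣ : ∀ {n} (S : Subset n) → ι ∣ S ∣ ≡ Σ[ allFin n ] (λ u → ⟦ u ∈? S ⟧)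
ι-∣∣ []                    = refl
ι-∣∣ {suc n} (inside  ∷ S) = trans (ι-suc ∣ S ∣) (trans (cong (1ℚ +_) (ι-∣∣ S)) (sym (Σ-allFin-suc n (λ u → ⟦ u ∈? (inside ∷ S) ⟧))))
ι-∣∣ {suc n} (outside ∷ S) = trans (ι-∣∣ S) (trans (sym (ℚ.+-identityˡ _)) (sym (Σ-allFin-suc n (λ u → ⟦ u ∈? (outside ∷ S) ⟧))))

module Orientations {n} (G : Graph n) where
  open Graph G
  open Restrict G
  open Functional n

  -- α̂ U is the number of acyclic orientations of the subgraph induced on U,
  -- and Q W M the number of those on W whose sinks all lie in M.

  α̂ : Subset n → ℚ
  α̂ U = η n (𝒳 U)

  -- A term of inclusion-exclusion over sets of sinks. For stable S ⊆ W, the acyclic orientations of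
  -- W in which all of S are sinks correspond to those of W ─ S, because the edges at S are forced.
  -- Summing over S outside M discards every orientation with a sink outside M.
  term : Subset n → Subset n → ℚ
  term W S = sgn ∣ S ∣ * α̂ (W ─ S)

  Adm : Subset n → Subset n → Subset n → Set
  Adm W M S = (∀ u → u ∈ˢ S → u ∈ˢ W × u ∉ˢ M) × Stable G S

  adm? : ∀ W M S → Dec (Adm W M S)
  adm? W M S = (Fin.all? λ u → (u ∈? S) →-dec ((u ∈? W) ×-dec (u ∉? M))) ×-dec stable? G S

  Q : Subset n → Subset n → ℚ
  Q W M = Σ[ subsets n ] (λ S → ⟦ adm? W M S ⟧ * term W S)

  -- Here M excludes nothing, and the sum is that of `η-inverse`. Its value counts colourings of W
  -- with no colours: 1 if W is empty and 0 otherwise, matching the fact that a nonempty acyclic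
  -- orientation has a sink.
  Q-disjoint : ∀ W M → (∀ u → u ∈ˢ W → u ∉ˢ M) → Q W M ≡ 𝒳 W 0 []
  Q-disjoint W M disjoint = begin
    Q W M
      ≡⟨ Σ-ext (subsets n) (λ S → cong (_* term W S) (⟦⟧-cong (adm? W M S) (stable⊆? W S)
           (λ (f , st) → (λ u∈S → proj₁ (f _ u∈S)) , st)
           (λ (S⊆W , st) → (λ u u∈S → S⊆W u∈S , disjoint u (S⊆W u∈S)) , st))) ⟩
    Σ[ subsets n ] (λ S → ⟦ stable⊆? W S ⟧ * term W S)
      ≡⟨ Σ-remove W (λ (j , U) → sgn j * α̂ U) ⟨
    Σ[ remove W ] (λ (j , U) → sgn j * α̂ U)
      ≡⟨ η-inverse n 𝒳-recurrence W (Sub.∣p∣≤n W) ⟩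
    𝒳 W 0 [] ∎
    where open ≡-Reasoning

  nbr : Fin n → Subset n
  nbr x = tabulate (λ v → does (x ~? v))

  ∈-nbr⁺ : ∀ {x v} → x ~ v → v ∈ˢ nbr x
  ∈-nbr⁺ {x} {v} x~v = Vec.lookup⇒[]= v (nbr x) (trans (Vec.lookup∘tabulate _ v) (dec-true (x ~? v) x~v))

  ∈-nbr⁻ : ∀ {x v} → v ∈ˢ nbr x → x ~ v
  ∈-nbr⁻ {x} {v} v∈ with x ~? v in eq
  ... | yes x~v = x~v
  ... | no _ with () ← trans (sym (Vec.[]=⇒lookup v∈)) (trans (Vec.lookup∘tabulate (λ v → does (x ~? v)) v) (cong does eq))

  adm-insert⁻ : ∀ {W M x S} → x ∉ˢ S × Adm W M (⁅ x ⁆ ∪ S) → Adm (W ∖ x) (M ∪ nbr x) S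
  adm-insert⁻ {W} {M} {x} {S} (x∉S , f , stable) = g , λ u u∈S v v∈S → stable u (S⊆ u∈S) v (S⊆ v∈S)
    where
    S⊆ : S ⊆ ⁅ x ⁆ ∪ S
    S⊆ = Sub.q⊆p∪q ⁅ x ⁆ S
    g : ∀ u → u ∈ˢ S → u ∈ˢ W ∖ x × u ∉ˢ M ∪ nbr x
    g u u∈S = Sub.x∈p∧x≢y⇒x∈p-y (proj₁ (f u (S⊆ u∈S))) (λ { refl → x∉S u∈S }) , λ u∈ → case (Sub.x∈p∪q⁻ M (nbr x) u∈)
      where
      case : u ∈ˢ M ⊎ u ∈ˢ nbr x → Empty.⊥
      case (inj₁ u∈M) = proj₂ (f u (S⊆ u∈S)) u∈M
      case (inj₂ u∈N) = stable x (Sub.p⊆p∪q S (Sub.x∈⁅x⁆ x)) u (S⊆ u∈S) (∈-nbr⁻ u∈N)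

  adm-insert⁺ : ∀ {W M x S} → x ∈ˢ W → x ∉ˢ M → Adm (W ∖ x) (M ∪ nbr x) S → x ∉ˢ S × Adm W M (⁅ x ⁆ ∪ S)
  adm-insert⁺ {W} {M} {x} {S} x∈W x∉M (f , stable) = (λ x∈S → x∉p∖x x (proj₁ (f x x∈S))) , g , stable′
    where
    split : ∀ {u} → u ∈ˢ ⁅ x ⁆ ∪ S → u ≡ x ⊎ u ∈ˢ S
    split u∈ with Sub.x∈p∪q⁻ ⁅ x ⁆ S u∈
    ... | inj₁ u∈⁅x⁆ = inj₁ (Sub.x∈⁅y⁆⇒x≡y x u∈⁅x⁆)
    ... | inj₂ u∈S   = inj₂ u∈S
    g : ∀ u → u ∈ˢ ⁅ x ⁆ ∪ S → u ∈ˢ W × u ∉ˢ M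
    g u u∈ with split u∈
    ... | inj₁ refl = x∈W , x∉M
    ... | inj₂ u∈S  = Sub.p─q⊆p W ⁅ x ⁆ (proj₁ (f u u∈S)) , proj₂ (f u u∈S) ∘ Sub.p⊆p∪q (nbr x)
    x≁S : ∀ {v} → v ∈ˢ S → ¬ (x ~ v)
    x≁S v∈S x~v = proj₂ (f _ v∈S) (Sub.q⊆p∪q M (nbr x) (∈-nbr⁺ x~v))
    stable′ : Stable G (⁅ x ⁆ ∪ S)
    stable′ u u∈ v v∈ u~v with split u∈ | split v∈
    ... | inj₁ refl | inj₁ refl = ~-irrefl refl u~v
    ... | inj₁ refl | inj₂ v∈S  = x≁S v∈S u~v
    ... | inj₂ u∈S  | inj₁ refl = x≁S u∈S (~-sym u~v)
    ... | inj₂ u∈S  | inj₂ v∈S  = stable u u∈S v v∈S u~v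

  term-insert : ∀ W {x S} → x ∉ˢ S → term W (⁅ x ⁆ ∪ S) ≡ - term (W ∖ x) S
  term-insert W {x} {S} x∉S = begin
    sgn ∣ ⁅ x ⁆ ∪ S ∣ * α̂ (W ─ (⁅ x ⁆ ∪ S))  ≡⟨ cong₂ (λ k U → sgn k * α̂ U) (∣⁅⁆∪∣ x∉S) (sym (Sub.p─q─r≡p─q∪r W ⁅ x ⁆ S)) ⟩
    - sgn ∣ S ∣ * α̂ ((W ∖ x) ─ S)             ≡⟨ ℚ.neg-distribˡ-* (sgn ∣ S ∣) _ ⟨
    - term (W ∖ x) S                          ∎
    where open ≡-Reasoning

  -- Taking x out of the stable set flips the sign and deletes x from W. Stability together with x
  -- forbids the neighbours of x, which is recorded by adding them to M.
  Σ-insert : ∀ {W M x} → x ∈ˢ W → x ∉ˢ M →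
             Σ[ subsets n ] (λ S → ⟦ x ∉? S ⟧ * (⟦ adm? W M (⁅ x ⁆ ∪ S) ⟧ * term W (⁅ x ⁆ ∪ S))) ≡ - Q (W ∖ x) (M ∪ nbr x)
  Σ-insert {W} {M} {x} x∈W x∉M = begin
    Σ[ subsets n ] (λ S → ⟦ x ∉? S ⟧ * (⟦ adm? W M (⁅ x ⁆ ∪ S) ⟧ * term W (⁅ x ⁆ ∪ S)))
      ≡⟨ Σ-ext (subsets n) pointwise ⟩
    Σ[ subsets n ] (λ S → - (⟦ adm? (W ∖ x) (M ∪ nbr x) S ⟧ * term (W ∖ x) S))
      ≡⟨ Σ-neg (subsets n) _ ⟩
    - Q (W ∖ x) (M ∪ nbr x) ∎
    where
      open ≡-Reasoning
      pointwise : ∀ S → ⟦ x ∉? S ⟧ * (⟦ adm? W M (⁅ x ⁆ ∪ S) ⟧ * term W (⁅ x ⁆ ∪ S)) ≡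
                        - (⟦ adm? (W ∖ x) (M ∪ nbr x) S ⟧ * term (W ∖ x) S)
      pointwise S = begin
        ⟦ x ∉? S ⟧ * (⟦ adm? W M (⁅ x ⁆ ∪ S) ⟧ * term W (⁅ x ⁆ ∪ S))
          ≡⟨ ℚ.*-assoc ⟦ x ∉? S ⟧ _ _ ⟨
        ⟦ x ∉? S ⟧ * ⟦ adm? W M (⁅ x ⁆ ∪ S) ⟧ * term W (⁅ x ⁆ ∪ S)
          ≡⟨ cong (_* term W (⁅ x ⁆ ∪ S)) (trans (sym (⟦⟧-× (x ∉? S) (adm? W M (⁅ x ⁆ ∪ S))))
               (⟦⟧-cong ((x ∉? S) ×-dec adm? W M (⁅ x ⁆ ∪ S)) (adm? (W ∖ x) (M ∪ nbr x) S) adm-insert⁻ (adm-insert⁺ x∈W x∉M))) ⟩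
        ⟦ adm? (W ∖ x) (M ∪ nbr x) S ⟧ * term W (⁅ x ⁆ ∪ S)
          ≡⟨ ⟦⟧-*-cong (adm? (W ∖ x) (M ∪ nbr x) S) (λ adm → term-insert W (proj₁ (adm-insert⁺ x∈W x∉M adm))) ⟩
        ⟦ adm? (W ∖ x) (M ∪ nbr x) S ⟧ * - term (W ∖ x) S
          ≡⟨ ℚ.neg-distribʳ-* ⟦ adm? (W ∖ x) (M ∪ nbr x) S ⟧ _ ⟨
        - (⟦ adm? (W ∖ x) (M ∪ nbr x) S ⟧ * term (W ∖ x) S) ∎

  -- The two summands count the orientations in which x ∈ M is not a sink,
  -- respectively is one; in the latter case x can be deleted.

  Q-step : ∀ {W M x} → x ∈ˢ W → x ∈ˢ M → Q W M ≡ Q W (M ∖ x) + Q (W ∖ x) ((M ∖ x) ∪ nbr x)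
  Q-step {W} {M} {x} x∈W x∈M = begin
    Q W M                                              ≡⟨ cancel (Q W M) q ⟩
    Q W M + - q + q                                    ≡⟨ cong (_+ q) (cong₂ _+_ (Σ-ext (subsets n) avoid) (sym (Σ-insert x∈W (x∉p∖x x)))) ⟩
    Σ[ subsets n ] (λ S → ⟦ x ∉? S ⟧ * f S) + Σ[ subsets n ] (λ S → ⟦ x ∉? S ⟧ * f (⁅ x ⁆ ∪ S)) + q
                                                       ≡⟨ cong (_+ q) (Σ-subsets-split x f) ⟨
    Q W (M ∖ x) + q                                    ∎
    where
      open ≡-Reasoning
      open +-*-Solver using (solve; _:+_; :-_; _:=_)
      q = Q (W ∖ x) ((M ∖ x) ∪ nbr x)
      f : Subset n → ℚ
      f S = ⟦ adm? W (M ∖ x) S ⟧ * term W S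
      cancel : ∀ a b → a ≡ a + - b + b
      cancel = solve 2 (λ a b → a := a :+ :- b :+ b) refl
      avoid : ∀ S → ⟦ adm? W M S ⟧ * term W S ≡ ⟦ x ∉? S ⟧ * f S
      avoid S = trans
        (cong (_* term W S) (trans
          (⟦⟧-cong (adm? W M S) ((x ∉? S) ×-dec adm? W (M ∖ x) S)
            (λ (g , st) → (λ x∈S → proj₂ (g x x∈S) x∈M) , (λ u u∈S → proj₁ (g u u∈S) , proj₂ (g u u∈S) ∘ Sub.p─q⊆p M ⁅ x ⁆) , st)
            (λ (x∉S , g , st) → (λ u u∈S → proj₁ (g u u∈S) , λ u∈M → proj₂ (g u u∈S) (Sub.x∈p∧x≢y⇒x∈p-y u∈M λ { refl → x∉S u∈S })) , st))
          (⟦⟧-× (x ∉? S) (adm? W (M ∖ x) S))))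
        (ℚ.*-assoc ⟦ x ∉? S ⟧ _ _)

  ∣∖∣≤ : ∀ {x : Fin n} {p k} → x ∈ˢ p → ∣ p ∣ ℕ.≤ suc k → ∣ p ∖ x ∣ ℕ.≤ k
  ∣∖∣≤ x∈p ∣p∣≤ = ℕ.s≤s⁻¹ (ℕ.≤-trans (Sub.x∈p⇒∣p-x∣<∣p∣ x∈p) ∣p∣≤)

  ∣∣≰0 : ∀ {x : Fin n} {p} → x ∈ˢ p → ¬ (∣ p ∣ ℕ.≤ 0)
  ∣∣≰0 x∈p ∣p∣≤ = ℕ.n≮0 (ℕ.≤-trans (Sub.x∈p⇒∣p-x∣<∣p∣ x∈p) ∣p∣≤)

  -- Lexicographic induction on the sizes of W and M, bounded by `l` and `m`. The first branch of
  -- `Q-step` shrinks M; the second shrinks W but may enlarge M, so its bound on M restarts at n.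
  Q≥0′ : ∀ l m W M → ∣ W ∣ ℕ.≤ l → ∣ M ∣ ℕ.≤ m → 0ℚ ≤ Q W M
  Q≥0′ l m W M W≤l M≤m with Fin.any? (λ x → (x ∈? W) ×-dec (x ∈? M))
  ... | no ¬meet = subst (0ℚ ≤_) (sym (Q-disjoint W M λ u u∈W u∈M → ¬meet (u , u∈W , u∈M)))
                     (Σ≥0 (colourings 0 W) (λ κ _ → ⟦⟧≥0 (proper′? κ ×-dec Vec.≡-dec ℕ._≟_ (content′ κ) [])))
  Q≥0′ zero    m       W M W≤l M≤m | yes (x , x∈W , x∈M) = contradiction W≤l (∣∣≰0 x∈W)
  Q≥0′ (suc l) zero    W M W≤l M≤m | yes (x , x∈W , x∈M) = contradiction M≤m (∣∣≰0 x∈M)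
  Q≥0′ (suc l) (suc m) W M W≤l M≤m | yes (x , x∈W , x∈M) = subst (0ℚ ≤_) (sym (Q-step x∈W x∈M))
    (ℚ.+-mono-≤ (Q≥0′ (suc l) m W (M ∖ x) W≤l (∣∖∣≤ x∈M M≤m))
                (Q≥0′ l n (W ∖ x) ((M ∖ x) ∪ nbr x) (∣∖∣≤ x∈W W≤l) (Sub.∣p∣≤n ((M ∖ x) ∪ nbr x))))

  Q≥0 : ∀ W M → 0ℚ ≤ Q W M
  Q≥0 W M = Q≥0′ n n W M (Sub.∣p∣≤n W) (Sub.∣p∣≤n M)

  -- Connection to M by a walk inside W. An acyclic orientation of W with all sinks in M exists
  -- exactly when every vertex of W has one: following directed edges ends at a sink.
  data Reach (W M : Subset n) : Fin n → Set where
    root : ∀ {u} → u ∈ˢ W → u ∈ˢ M → Reach W M u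
    edge : ∀ {u v} → Reach W M u → u ~ v → v ∈ˢ W → Reach W M v

  reach-root : ∀ {W M u} → Reach W M u → ∃[ x ] (x ∈ˢ W × x ∈ˢ M)
  reach-root (root u∈W u∈M) = _ , u∈W , u∈M
  reach-root (edge r _ _)   = reach-root r

  -- A walk that passes through the deleted x can be restarted just after x, since that vertex is a
  -- neighbour of x and therefore a new root.
  reach-∖ : ∀ {W M x u} → Reach W M u → u ≢ x → Reach (W ∖ x) ((M ∖ x) ∪ nbr x) u
  reach-∖ {x = x} (root u∈W u∈M) u≢x =
    root (Sub.x∈p∧x≢y⇒x∈p-y u∈W u≢x) (Sub.p⊆p∪q (nbr x) (Sub.x∈p∧x≢y⇒x∈p-y u∈M u≢x))
  reach-∖ {M = M} {x} (edge {u} r u~v v∈W) v≢x with u Fin.≟ x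
  ... | yes refl = root (Sub.x∈p∧x≢y⇒x∈p-y v∈W v≢x) (Sub.q⊆p∪q (M ∖ x) (nbr x) (∈-nbr⁺ u~v))
  ... | no u≢x   = edge (reach-∖ r u≢x) u~v (Sub.x∈p∧x≢y⇒x∈p-y v∈W v≢x)

  -- Only the branch of `Q-step` that deletes a root x as a sink is followed, the other being
  -- nonnegative. Reachability survives the deletion, so the recursion ends at empty W, where the
  -- count is 1.
  Q>0 : ∀ l W M → ∣ W ∣ ℕ.≤ l → (∀ {u} → u ∈ˢ W → Reach W M u) → 0ℚ < Q W M
  Q>0 l W M W≤l reach with Sub.nonempty? W
  ... | no empty with refl ← Sub.Empty-unique empty =
    subst (0ℚ <_) (sym (trans (Q-disjoint ⊥ M (λ u u∈⊥ → contradiction u∈⊥ Sub.∉⊥)) 𝒳-⊥)) (ℚ.positive⁻¹ 1ℚ)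
  Q>0 zero    W M W≤l reach | yes (u , u∈W) = contradiction W≤l (∣∣≰0 u∈W)
  Q>0 (suc l) W M W≤l reach | yes (u , u∈W) with x , x∈W , x∈M ← reach-root (reach u∈W) =
    subst (0ℚ <_) (sym (Q-step x∈W x∈M))
      (ℚ.+-mono-≤-< (Q≥0 W (M ∖ x))
        (Q>0 l (W ∖ x) ((M ∖ x) ∪ nbr x) (∣∖∣≤ x∈W W≤l)
          (λ v∈ → reach-∖ (reach (Sub.p─q⊆p W ⁅ x ⁆ v∈)) (λ { refl → x∉p∖x x v∈ }))))

  -- The u-th summand counts acyclic orientations with u as only sink: once u is deleted, new sinks
  -- can only be neighbours of u. The factor ∣ S ∣ in `φ` is written as a sum over u ∈ S, and for
  -- each u the vertex is moved out of S at the cost of a sign, which cancels the outer one.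
  φ-X : φ (X G) ≡ Σ[ allFin n ] (λ u → Q (⊤ ∖ u) (nbr u))
  φ-X = begin
    φ (X G)
      ≡⟨ φ-cong X≡𝒳⊤ ⟩
    φ (𝒳 ⊤)
      ≡⟨ Ψ-series n 𝒳-recurrence (λ k → ι k * w k) n ⊤ (Sub.∣p∣≤n ⊤) ⟩
    Σ[ remove ⊤ ] (λ (j , U) → ι j * w j * α̂ U)
      ≡⟨ Σ-remove ⊤ (λ (j , U) → ι j * w j * α̂ U) ⟩
    Σ[ subsets n ] (λ S → ⟦ stable⊆? ⊤ S ⟧ * (ι ∣ S ∣ * w ∣ S ∣ * α̂ (⊤ ─ S)))
      ≡⟨ Σ-ext (subsets n) expand ⟩
    Σ[ subsets n ] (λ S → - Σ[ allFin n ] (λ u → ⟦ u ∈? S ⟧ * f S))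
      ≡⟨ trans (Σ-neg (subsets n) _) (cong -_ (Σ-swap (subsets n) (allFin n) _)) ⟩
    - Σ[ allFin n ] (λ u → Σ[ subsets n ] (λ S → ⟦ u ∈? S ⟧ * f S))
      ≡⟨ Σ-neg (allFin n) _ ⟨
    Σ[ allFin n ] (λ u → - Σ[ subsets n ] (λ S → ⟦ u ∈? S ⟧ * f S))
      ≡⟨ Σ-ext (allFin n) (λ u → trans (cong -_ (containing u)) (neg-neg (Q (⊤ ∖ u) (nbr u)))) ⟩
    Σ[ allFin n ] (λ u → Q (⊤ ∖ u) (nbr u)) ∎
    where
      open ≡-Reasoning
      open +-*-Solver using (solve; _:*_; :-_; _:=_)
      f : Subset n → ℚ
      f S = ⟦ adm? ⊤ ⊥ S ⟧ * term ⊤ S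
      neg-neg : ∀ a → - - a ≡ a
      neg-neg = solve 1 (λ a → :- :- a := a) refl
      rearrange : ∀ d i s a → d * (- (i * s) * a) ≡ - (d * (s * a) * i)
      rearrange = solve 4 (λ d i s a → d :* (:- (i :* s) :* a) := :- (d :* (s :* a) :* i)) refl
      expand : ∀ S → ⟦ stable⊆? ⊤ S ⟧ * (ι ∣ S ∣ * w ∣ S ∣ * α̂ (⊤ ─ S)) ≡ - Σ[ allFin n ] (λ u → ⟦ u ∈? S ⟧ * f S)
      expand S = begin
        ⟦ stable⊆? ⊤ S ⟧ * (ι ∣ S ∣ * w ∣ S ∣ * α̂ (⊤ ─ S))
          ≡⟨ cong₂ (λ d x → d * (x * α̂ (⊤ ─ S)))
               (⟦⟧-cong (stable⊆? ⊤ S) (adm? ⊤ ⊥ S) (λ (_ , st) → (λ _ _ → Sub.∈⊤ , Sub.∉⊥) , st) (λ (_ , st) → Sub.⊆⊤ , st))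
               (ι*w ∣ S ∣) ⟩
        ⟦ adm? ⊤ ⊥ S ⟧ * (- (ι ∣ S ∣ * sgn ∣ S ∣) * α̂ (⊤ ─ S))
          ≡⟨ rearrange ⟦ adm? ⊤ ⊥ S ⟧ (ι ∣ S ∣) (sgn ∣ S ∣) (α̂ (⊤ ─ S)) ⟩
        - (f S * ι ∣ S ∣)
          ≡⟨ cong (λ x → - (f S * x)) (ι-∣∣ S) ⟩
        - (f S * Σ[ allFin n ] (λ u → ⟦ u ∈? S ⟧))
          ≡⟨ cong -_ (Σ-* (allFin n) (f S) (λ u → ⟦ u ∈? S ⟧)) ⟨
        - Σ[ allFin n ] (λ u → f S * ⟦ u ∈? S ⟧)
          ≡⟨ cong -_ (Σ-ext (allFin n) (λ u → ℚ.*-comm (f S) ⟦ u ∈? S ⟧)) ⟩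
        - Σ[ allFin n ] (λ u → ⟦ u ∈? S ⟧ * f S) ∎
      containing : ∀ u → Σ[ subsets n ] (λ S → ⟦ u ∈? S ⟧ * f S) ≡ - Q (⊤ ∖ u) (nbr u)
      containing u = begin
        Σ[ subsets n ] (λ S → ⟦ u ∈? S ⟧ * f S)
          ≡⟨ Σ-subsets-split u (λ S → ⟦ u ∈? S ⟧ * f S) ⟩
        Σ[ subsets n ] (λ S → ⟦ u ∉? S ⟧ * (⟦ u ∈? S ⟧ * f S)) + Σ[ subsets n ] (λ S → ⟦ u ∉? S ⟧ * (⟦ u ∈? (⁅ u ⁆ ∪ S) ⟧ * f (⁅ u ⁆ ∪ S)))
          ≡⟨ cong₂ _+_ (Σ-zero (subsets n) (λ S _ → exclusive S)) (Σ-ext (subsets n) present) ⟩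
        0ℚ + Σ[ subsets n ] (λ S → ⟦ u ∉? S ⟧ * f (⁅ u ⁆ ∪ S))
          ≡⟨ ℚ.+-identityˡ _ ⟩
        Σ[ subsets n ] (λ S → ⟦ u ∉? S ⟧ * f (⁅ u ⁆ ∪ S))
          ≡⟨ Σ-insert Sub.∈⊤ Sub.∉⊥ ⟩
        - Q (⊤ ∖ u) (⊥ ∪ nbr u)
          ≡⟨ cong (λ M → - Q (⊤ ∖ u) M) (Sub.∪-identityˡ (nbr u)) ⟩
        - Q (⊤ ∖ u) (nbr u) ∎
        where
          exclusive : ∀ S → ⟦ u ∉? S ⟧ * (⟦ u ∈? S ⟧ * f S) ≡ 0ℚ
          exclusive S = trans
            (⟦⟧-*-cong (u ∉? S) (λ u∉S → trans (cong (_* f S) (⟦⟧-no (u ∈? S) u∉S)) (ℚ.*-zeroˡ (f S))))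
            (ℚ.*-zeroʳ ⟦ u ∉? S ⟧)
          present : ∀ S → ⟦ u ∉? S ⟧ * (⟦ u ∈? (⁅ u ⁆ ∪ S) ⟧ * f (⁅ u ⁆ ∪ S)) ≡ ⟦ u ∉? S ⟧ * f (⁅ u ⁆ ∪ S)
          present S = cong (⟦ u ∉? S ⟧ *_) (trans
            (cong (_* f (⁅ u ⁆ ∪ S)) (⟦⟧-yes (u ∈? (⁅ u ⁆ ∪ S)) (Sub.p⊆p∪q S (Sub.x∈⁅x⁆ u))))
            (ℚ.*-identityˡ (f (⁅ u ⁆ ∪ S))))

  φ-X>0 : Connected G → 0ℚ < φ (X G)
  φ-X>0 (n≢0 , connected) = subst (0ℚ <_) (sym φ-X)
    (Σ>0 (∈.∈-allFin (first n≢0)) (λ u _ → Q≥0 (⊤ ∖ u) (nbr u))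
         (Q>0 n (⊤ ∖ first n≢0) (nbr (first n≢0)) (Sub.∣p∣≤n (⊤ ∖ first n≢0))
              (λ {v} v∈ → walk (connected (first n≢0) v) (inj₁ refl) (λ { refl → x∉p∖x (first n≢0) v∈ }))))
    where
    first : ∀ {m} → ℕ.NonZero m → Fin m
    first {suc m} _ = zero
    ∈⊤∖ : ∀ {u v : Fin n} → v ≢ u → v ∈ˢ ⊤ ∖ u
    ∈⊤∖ = Sub.x∈p∧x≢y⇒x∈p-y Sub.∈⊤
    -- The path from u may return to u. `inj₁` means that it is currently at u, and then the next
    -- vertex other than u is a root because it is a neighbour of u.
    walk : ∀ {u v v′} → Star _~_ v v′ → v ≡ u ⊎ Reach (⊤ ∖ u) (nbr u) v → v′ ≢ u → Reach (⊤ ∖ u) (nbr u) v′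
    walk ε          (inj₁ v≡u) v′≢u = contradiction v≡u v′≢u
    walk ε          (inj₂ r)   v′≢u = r
    walk {u} (_◅_ {j = v₁} v~v₁ path) r v′≢u = walk path (extend r) v′≢u
      where
      extend : _ → v₁ ≡ u ⊎ Reach (⊤ ∖ u) (nbr u) v₁
      extend r with v₁ Fin.≟ u
      ... | yes v₁≡u = inj₁ v₁≡u
      extend (inj₁ refl) | no v₁≢u = inj₂ (root (∈⊤∖ v₁≢u) (∈-nbr⁺ v~v₁))
      extend (inj₂ r)    | no v₁≢u = inj₂ (edge r v~v₁ (∈⊤∖ v₁≢u))

-- Comparing the two graphs

partitions-⊢ : ∀ n {λs} → λs ∈ partitions n → λs ⊢ n
partitions-⊢ n λs∈ = proj₂ (∈.∈-filter⁻ (_⊢? n) {xs = candidates} λs∈)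
  where candidates = List.concatMap (λ ℓ → map Vec.toList (sequences (upTo (suc n)) ℓ)) (upTo (suc n))

-- If p ≤ 0, then applying `φ` to the expansion gives only terms that are at most 0: the term of (n)
-- is p and the others vanish. Bounding every term avoids locating (n) in the list of partitions.
-- The outcome contradicts φ(X_G) > 0.
[e-n]>0 : ∀ {n} (G : Graph n) p → Connected G → ECoefficient n (n ∷ []) (X G) p → 0ℚ < p
[e-n]>0 {n} G p conn@(n≢0 , _) (c , expansion , c≡p) =
  ℚ.≰⇒> λ p≤0 → ℚ.<-irrefl refl (ℚ.<-≤-trans (Orientations.φ-X>0 G conn) (φ-X≤0 p≤0))
  where
  open Functional n
  c*x≤0 : ∀ c {x} → c ≤ 0ℚ → x ≡ 1ℚ → c * x ≤ 0ℚ
  c*x≤0 c c≤0 refl = ℚ.≤-trans (ℚ.≤-reflexive (ℚ.*-identityʳ c)) c≤0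
  c*x≡0 : ∀ c {x} → x ≡ 0ℚ → c * x ≡ 0ℚ
  c*x≡0 c refl = ℚ.*-zeroʳ c
  term≤0 : p ≤ 0ℚ → ∀ λs → λs ⊢ n → c λs * φ e[ λs ] ≤ 0ℚ
  term≤0 p≤0 [] (_ , _ , 0≡n) = contradiction (sym 0≡n) (ℕ.≢-nonZero⁻¹ n {{n≢0}})
  term≤0 p≤0 (zero ∷ _) (() ∷ _ , _)
  term≤0 p≤0 (suc m ∷ []) (_ , _ , sum≡n) = c*x≤0 (c (suc m ∷ [])) (subst (_≤ 0ℚ) (sym c≡p′) p≤0)
    (φ-e n m [] (ℕ.≤-reflexive sum≡n))
    where
    c≡p′ : c (suc m ∷ []) ≡ p
    -- `sum≡n` has the form suc m + 0 ≡ n, so the trailing 0 is removed before the two one-part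
    -- partitions can be compared.
    c≡p′ = trans (cong (λ k → c (k ∷ [])) (trans (sym (ℕ.+-identityʳ (suc m))) sum≡n)) c≡p
  term≤0 p≤0 (suc m ∷ zero ∷ _) (_ ∷ () ∷ _ , _)
  term≤0 p≤0 (suc m ∷ suc k ∷ λs′) (_ , _ , sum≡n) = ℚ.≤-reflexive (c*x≡0 (c (suc m ∷ suc k ∷ λs′))
    (trans (φ-e n m (suc k ∷ λs′) (ℕ.≤-reflexive sum≡n)) (trans (ℚ.+-identityʳ (0ℚ * e[ λs′ ] 0 [])) (ℚ.*-zeroˡ (e[ λs′ ] 0 [])))))
  φ-X≤0 : p ≤ 0ℚ → φ (X G) ≤ 0ℚ
  φ-X≤0 p≤0 = begin
    φ (X G)                                                        ≡⟨ φ-cong {X G} {λ N a → Σ[ partitions n ] (λ λs → c λs * e[ λs ] N a)} expansion ⟩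
    φ (λ N a → Σ[ partitions n ] (λ λs → c λs * e[ λs ] N a))      ≡⟨ φ-Σ (partitions n) c e[_] ⟩
    Σ[ partitions n ] (λ λs → c λs * φ e[ λs ])                    ≤⟨ Σ≤0 (partitions n) (λ λs λs∈ → term≤0 p≤0 λs (partitions-⊢ n λs∈)) ⟩
    0ℚ                                                             ∎
    where open ℚ.≤-Reasoning

EPositive⇒≥0 : ∀ {n F} → EPositive n F → ∀ N a → 0ℚ ≤ F N a
EPositive⇒≥0 {n} (c , expansion , c≥0) N a = subst (0ℚ ≤_) (sym (expansion N a))
  (Σ≥0 (partitions n) (λ λs λs∈ → *≥0 (c≥0 λs (partitions-⊢ n λs∈)) (e[]≥0 λs N a)))

0≤p-q⇒q≤p : ∀ {p q} → 0ℚ ≤ p - q → q ≤ p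
0≤p-q⇒q≤p {p} {q} 0≤p-q = begin
  q          ≡⟨ ℚ.+-identityˡ q ⟨
  0ℚ + q     ≤⟨ ℚ.+-monoˡ-≤ q 0≤p-q ⟩
  p - q + q  ≡⟨ solve 2 (λ p q → p :- q :+ q := p) refl p q ⟩
  p          ∎
  where
  open ℚ.≤-Reasoning
  open +-*-Solver using (solve; _:+_; _:-_; _:=_)

≥ₑ⇒X>0 : ∀ {n} {G H : Graph n} → Connected G → Connected H → G ≥ₑ H → ∀ N a → 0ℚ < X H N a → 0ℚ < X G N a
≥ₑ⇒X>0 {n} {G} {H} connG connH (p , q , q≢0 , p-coeff , q-coeff , positive-difference) N a X>0 =
  ℚ.<-≤-trans (ℚ.positive⁻¹ (r * X H N a) {{ℚ.pos*pos⇒pos r {{r-pos}} (X H N a) {{positive X>0}}}}) rX≤X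
  where
  r = (p ÷ q) {{q≢0}}
  p-pos = positive ([e-n]>0 G p connG p-coeff)
  q-pos = positive ([e-n]>0 H q connH q-coeff)
  r-pos : Positive r
  r-pos = ℚ.pos*pos⇒pos p {{p-pos}} _ {{ℚ.1/pos⇒pos q {{q-pos}}}}
  rX≤X : r * X H N a ≤ X G N a
  rX≤X = 0≤p-q⇒q≤p (EPositive⇒≥0 {F = Xₑ G H p q {{q≢0}}} positive-difference N a)

-- Stable sets as colour classes of the monomials of X.

subsets-complete : ∀ {n} (S : Subset n) → S ∈ subsets n
subsets-complete []            = here refl
subsets-complete (inside ∷ S)  = ∈.∈-cartesianProductWith⁺ _∷_ {xs = inside ∷ outside ∷ []} (here refl) (subsets-complete S)
subsets-complete (outside ∷ S) = ∈.∈-cartesianProductWith⁺ _∷_ {xs = inside ∷ outside ∷ []} (there (here refl)) (subsets-complete S)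

sequences-complete : ∀ {N n} (κ : Vec (Fin N) n) → κ ∈ sequences (allFin N) n
sequences-complete []      = here refl
sequences-complete (i ∷ κ) = ∈.∈-cartesianProductWith⁺ _∷_ (∈.∈-allFin i) (sequences-complete κ)

module _ {n} (G : Graph n) where
  open Graph G

  Stable⇒∣∣≤α : ∀ {S} → Stable G S → ∣ S ∣ ℕ.≤ α G
  Stable⇒∣∣≤α {S} stable = All.lookup (Extrema.xs≤max 0 (map ∣_∣ (filter (stable? G) (subsets n))))
    (∈.∈-map⁺ ∣_∣ (∈.∈-filter⁺ (stable? G) (subsets-complete S) stable))

  α-attained : ∃[ S ] (Stable G S × ∣ S ∣ ≡ α G)
  α-attained with Extrema.argmax-sel id 0 (map ∣_∣ (filter (stable? G) (subsets n)))
  -- The maximum may be the default 0; the empty set attains it.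
  ... | inj₁ α≡0 = ⊥ , Restrict.stable-⊥ G , trans (Sub.∣⊥∣≡0 n) (sym α≡0)
  ... | inj₂ α∈ with S , S∈ , α≡ ← ∈.∈-map⁻ ∣_∣ α∈ =
    S , proj₂ (∈.∈-filter⁻ (stable? G) {xs = subsets n} S∈) , sym α≡

  X>0⁺ : ∀ {N} (κ : Vec (Fin N) n) → Proper G κ → 0ℚ < X G N (content κ)
  X>0⁺ {N} κ proper with filter P? (sequences (allFin N) n) | ∈.∈-filter⁺ P? (sequences-complete κ) (proper , refl)
    where
    P? : ∀ κ′ → Dec (Proper G κ′ × content κ′ ≡ content κ)
    P? κ′ = proper? G κ′ ×-dec Vec.≡-dec ℕ._≟_ (content κ′) (content κ)
  ... | κs@(_ ∷ κs′) | _ = ℚ.positive⁻¹ (ι (length κs)) {{ℚ.normalize-pos (length κs) 1}}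

  X>0⁻ : ∀ {N a} → 0ℚ < X G N a → ∃[ κ ] (Proper G κ × content κ ≡ a)
  X>0⁻ {N} {a} X>0 = find (filter P? κs) (proj₂ ∘ ∈.∈-filter⁻ P? {xs = κs}) X>0
    where
    κs = sequences (allFin N) n
    P? : ∀ κ → Dec (Proper G κ × content κ ≡ a)
    P? κ = proper? G κ ×-dec Vec.≡-dec ℕ._≟_ (content κ) a
    find : ∀ xs → (∀ {κ} → κ ∈ xs → Proper G κ × content κ ≡ a) → 0ℚ < ι (length xs) → ∃[ κ ] (Proper G κ × content κ ≡ a)
    find []       _    0<0 = contradiction 0<0 (ℚ.<-irrefl refl)
    find (κ ∷ xs) good _   = κ , good (here refl)

  private
    colour : ∀ {m N} → Subset m → (Fin m → Fin N) → Fin m → Fin (suc N)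
    colour S g v = if lookup S v then zero else suc (g v)

    count-colour : ∀ {m N} (S : Subset m) (g : Fin m → Fin N) → count (zero Fin.≟_) (tabulate (colour S g)) ≡ ∣ S ∣
    count-colour []            g = refl
    count-colour (inside ∷ S)  g = cong suc (count-colour S (g ∘ suc))
    count-colour (outside ∷ S) g = count-colour S (g ∘ suc)

    class : ∀ {m N} → Vec (Fin (suc N)) m → Subset m
    class = Vec.map (λ c → does (zero Fin.≟ c))

    ∣class∣ : ∀ {m N} (κ : Vec (Fin (suc N)) m) → ∣ class κ ∣ ≡ count (zero Fin.≟_) κ
    ∣class∣ []          = refl
    ∣class∣ (zero ∷ κ)  = cong suc (∣class∣ κ)
    ∣class∣ (suc _ ∷ κ) = ∣class∣ κ

    ∈-class⁻ : ∀ {m N} {κ : Vec (Fin (suc N)) m} {u} → u ∈ˢ class κ → lookup κ u ≡ zero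
    ∈-class⁻ {κ = zero ∷ κ}  Vec.here       = refl
    ∈-class⁻ {κ = _ ∷ κ}     (Vec.there u∈) = ∈-class⁻ {κ = κ} u∈

  stable⇒colouring : ∀ {S} → Stable G S → ∃[ κ ] (Proper G {suc n} κ × count (zero Fin.≟_) κ ≡ ∣ S ∣)
  stable⇒colouring {S} stable = tabulate (colour S id) , proper , count-colour S id
    where
    proper : Proper G (tabulate (colour S id))
    proper u v u~v rewrite Vec.lookup∘tabulate (colour S id) u | Vec.lookup∘tabulate (colour S id) v
      with lookup S u in Su | lookup S v in Sv
    ... | inside  | inside  = λ _ → stable u (Vec.lookup⇒[]= u S Su) v (Vec.lookup⇒[]= v S Sv) u~v
    ... | inside  | outside = λ ()
    ... | outside | inside  = λ ()
    -- With `g` = `id`, vertices outside S have equal colours only if they are equal, and no vertex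
    -- is adjacent to itself.
    ... | outside | outside = λ eq → ~-irrefl (Fin.suc-injective eq) u~v

  colouring⇒stable : ∀ {N} (κ : Vec (Fin (suc N)) n) → Proper G κ → ∃[ S ] (Stable G S × ∣ S ∣ ≡ count (zero Fin.≟_) κ)
  colouring⇒stable κ proper = class κ ,
    (λ u u∈ v v∈ u~v → proper u v u~v (trans (∈-class⁻ {κ = κ} u∈) (sym (∈-class⁻ {κ = κ} v∈)))) , ∣class∣ κ

proposition3p1 : ∀ (n : ℕ) (G H : Graph n) → Connected G → Connected H →
    G ≥ₑ H → α G ≥ α H
proposition3p1 n G H connG connH G≥H =
  let S , S-stable , ∣S∣≡α     = α-attained H
      κ , κ-proper , ∣κ₀∣≡∣S∣  = stable⇒colouring H S-stable
      κ′ , κ′-proper , same    = X>0⁻ G (≥ₑ⇒X>0 {G = G} {H} connG connH G≥H (suc n) (content κ) (X>0⁺ H κ κ-proper))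
      T , T-stable , ∣T∣≡∣κ′₀∣ = colouring⇒stable G κ′ κ′-proper
  -- Only the first entries of the two equal contents are compared: they are the sizes of the
  -- classes of colour zero in κ′ and κ.
  in ℕ.≤-trans (ℕ.≤-reflexive (sym (trans ∣T∣≡∣κ′₀∣ (trans (Vec.∷-injectiveˡ same) (trans ∣κ₀∣≡∣S∣ ∣S∣≡α)))))
               (Stable⇒∣∣≤α G T-stable)
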